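{- Let $a$ be a totally real algebraic integer. If $a$ is sparse (that is, if the $a$-convex hull $D(a)$ of $\{0,1\}$ in $\mathbb{R}$ has no limit points), then every algebraic conjugate of $a$ distinct from $a$ lies in the open interval $(0,1)$.
   Context: An algebraic number is totally real if all of its algebraic conjugates (the complex roots of its minimal polynomial over $\mathbb{Q}$) are real numbers. For $a \in \mathbb{R}$, a set $V \subseteq \mathbb{R}^n$ is called $a$-convex if for all $\mathbf{x}, \mathbf{y} \in V$ one has $a\mathbf{x} + (1-a)\mathbf{y} \in V$. The $a$-convex hull of a set $V\subseteq\mathbb{R}^n$ is the intersection of all $a$-convex subsets of $\mathbb{R}^n$ that contain $V$. $D(a)$ denotes the $a$-convex hull of $\{0,1\}$ in $\mathbb{R}$. Equivalently, set $D_0(X) = \{0,1\}$, $D_{n+1}(X) = \{ X f(X) + (1-X) g(X) : f, g \in D_n(X)\}$ for $n \ge 0$, and $D(X) = \bigcup_{n \ge 0} D_n(X) \subseteq \mathbb{Z}[X]$; then $D(a) = \{ f(a) : f \in D(X)\}$. A real number $a$ is called sparse if $D(a)$ has no limit points (in $\mathbb{R}$). -}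

module Defs where

open import Algebra.Bundles.Raw using (RawRing)
open import Data.Integer.Base using (ℤ)
open import Data.Nat.Base as ℕ using (ℕ)
import Data.Nat.Properties as ℕ
open import Data.Product.Base using (_×_; _,_; ∃; ∃-syntax; Σ-syntax)
open import Data.Rational.Base as ℚ using (ℚ; 0ℚ; 1ℚ; ½; ∣_∣)
import Data.Rational.Properties as ℚ
open import Data.Rational.Solver using (module +-*-Solver)
open import Data.Sum.Base using (_⊎_)
open import Data.Vec.Base using (Vec; []; _∷_)
open import Level using (0ℓ; _⊔_) renaming (suc to lsuc)
open import Relation.Binary.Definitions using (_Respects_)
open import Relation.Binary.PropositionalEquality using (_≡_; refl; sym; trans; cong; subst)
open import Relation.Nullary.Negation using (¬_)
open import Relation.Unary using (Pred; _∈_; _⊆_)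

-- A real number is a Cauchy sequence of rationals; equality of reals is
-- _≈_, not propositional equality.

IsCauchy : (ℕ → ℚ) → Set
IsCauchy x = ∀ ε → 0ℚ ℚ.< ε →
  ∃[ N ] ∀ m n → N ℕ.≤ m → N ℕ.≤ n → ∣ x m ℚ.- x n ∣ ℚ.< ε

record ℝ : Set where
  constructor mkℝ
  field
    seq    : ℕ → ℚ
    cauchy : IsCauchy seq

open ℝ public

infix  8 -_
infixl 7 _*_
infixl 6 _+_ _-_
infix  4 _≈_ _<_

_≈_ : ℝ → ℝ → Set
x ≈ y = ∀ ε → 0ℚ ℚ.< ε →
  ∃[ N ] ∀ n → N ℕ.≤ n → ∣ seq x n ℚ.- seq y n ∣ ℚ.< ε

_<_ : ℝ → ℝ → Set
x < y = ∃[ ε ] 0ℚ ℚ.< ε × ∃[ N ] ∀ n → N ℕ.≤ n → seq x n ℚ.+ ε ℚ.≤ seq y n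

private
  abstract
    half-pos : ∀ {ε} → 0ℚ ℚ.< ε → 0ℚ ℚ.< ½ ℚ.* ε
    half-pos {ε} ε>0 = subst (ℚ._< ½ ℚ.* ε) (ℚ.*-zeroʳ ½) (ℚ.*-monoʳ-<-pos ½ ε>0)

    halves : ∀ ε → ½ ℚ.* ε ℚ.+ ½ ℚ.* ε ≡ ε
    halves ε = trans (sym (ℚ.*-distribʳ-+ ε ½ ½)) (ℚ.*-identityˡ ε)

    const-cauchy : ∀ q → IsCauchy (λ _ → q)
    const-cauchy q ε ε>0 = 0 , λ _ _ _ _ →
      subst (λ t → ∣ t ∣ ℚ.< ε) (sym (ℚ.+-inverseʳ q)) ε>0

    +-cauchy : ∀ x y → IsCauchy x → IsCauchy y → IsCauchy (λ n → x n ℚ.+ y n)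
    +-cauchy x y cx cy ε ε>0 with cx _ (half-pos ε>0) | cy _ (half-pos ε>0)
    ... | N , hx | M , hy = N ℕ.⊔ M , λ m n Nm Nn → begin-strict
        ∣ (x m ℚ.+ y m) ℚ.- (x n ℚ.+ y n) ∣
          ≡⟨ cong ∣_∣ (regroup (x m) (y m) (x n) (y n)) ⟩
        ∣ (x m ℚ.- x n) ℚ.+ (y m ℚ.- y n) ∣
          ≤⟨ ℚ.∣p+q∣≤∣p∣+∣q∣ (x m ℚ.- x n) (y m ℚ.- y n) ⟩
        ∣ x m ℚ.- x n ∣ ℚ.+ ∣ y m ℚ.- y n ∣
          <⟨ ℚ.+-mono-< (hx m n (ℕ.m⊔n≤o⇒m≤o N M Nm) (ℕ.m⊔n≤o⇒m≤o N M Nn))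
                        (hy m n (ℕ.m⊔n≤o⇒n≤o N M Nm) (ℕ.m⊔n≤o⇒n≤o N M Nn)) ⟩
        ½ ℚ.* ε ℚ.+ ½ ℚ.* ε
          ≡⟨ halves ε ⟩
        ε ∎
      where
      open ℚ.≤-Reasoning
      regroup : ∀ a b c d → (a ℚ.+ b) ℚ.- (c ℚ.+ d) ≡ (a ℚ.- c) ℚ.+ (b ℚ.- d)
      regroup = solve 4 (λ a b c d → (a :+ b) :- (c :+ d) := (a :- c) :+ (b :- d)) refl
        where open +-*-Solver

    neg-cauchy : ∀ x → IsCauchy x → IsCauchy (λ n → ℚ.- x n)
    neg-cauchy x cx ε ε>0 with cx ε ε>0
    ... | N , h = N , λ m n Nm Nn →
        subst (ℚ._< ε) (trans (sym (ℚ.∣-p∣≡∣p∣ (x m ℚ.- x n))) (cong ∣_∣ (swap (x m) (x n))))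
          (h m n Nm Nn)
      where
      swap : ∀ a b → ℚ.- (a ℚ.- b) ≡ ℚ.- a ℚ.- ℚ.- b
      swap = solve 2 (λ a b → :- (a :- b) := :- a :- :- b) refl
        where open +-*-Solver

    bounded : ∀ {x} → IsCauchy x →
              ∃[ B ] 0ℚ ℚ.< B × ∃[ N ] ∀ n → N ℕ.≤ n → ∣ x n ∣ ℚ.< B
    bounded {x} cx with cx 1ℚ (ℚ.positive⁻¹ 1ℚ)
    ... | N , h = ∣ x N ∣ ℚ.+ 1ℚ
                , ℚ.+-mono-≤-< (ℚ.0≤∣p∣ (x N)) (ℚ.positive⁻¹ 1ℚ)
                , N , λ n Nn → begin-strict
        ∣ x n ∣                       ≡⟨ cong ∣_∣ (split (x n) (x N)) ⟩
        ∣ x N ℚ.+ (x n ℚ.- x N) ∣     ≤⟨ ℚ.∣p+q∣≤∣p∣+∣q∣ (x N) (x n ℚ.- x N) ⟩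
        ∣ x N ∣ ℚ.+ ∣ x n ℚ.- x N ∣   <⟨ ℚ.+-monoʳ-< ∣ x N ∣ (h n N Nn ℕ.≤-refl) ⟩
        ∣ x N ∣ ℚ.+ 1ℚ                ∎
      where
      open ℚ.≤-Reasoning
      split : ∀ a b → a ≡ b ℚ.+ (a ℚ.- b)
      split = solve 2 (λ a b → a := b :+ (a :- b)) refl
        where open +-*-Solver

    scale : ∀ {s ε} → 0ℚ ℚ.< s → 0ℚ ℚ.< ε → ∃[ δ ] 0ℚ ℚ.< δ × s ℚ.* δ ≡ ε
    scale {s} {ε} s>0 ε>0 = s⁻¹ ℚ.* ε
      , subst (ℚ._< s⁻¹ ℚ.* ε) (ℚ.*-zeroʳ s⁻¹) (ℚ.*-monoʳ-<-pos s⁻¹ {{ℚ.1/pos⇒pos s {{s-pos}}}} ε>0)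
      , trans (sym (ℚ.*-assoc s s⁻¹ ε))
          (trans (cong (ℚ._* ε) (ℚ.*-inverseʳ s {{s≢0}})) (ℚ.*-identityˡ ε))
      where
      s-pos : ℚ.Positive s
      s-pos = ℚ.positive s>0

      s≢0 : ℚ.NonZero s
      s≢0 = ℚ.pos⇒nonZero s {{s-pos}}

      s⁻¹ : ℚ
      s⁻¹ = (ℚ.1/ s) {{s≢0}}

    product-bound : ∀ p q {D δ} → 0ℚ ℚ.< D → ∣ p ∣ ℚ.< D → ∣ q ∣ ℚ.< δ → ∣ p ℚ.* q ∣ ℚ.< D ℚ.* δ
    product-bound p q {D} {δ} D>0 p<D q<δ = begin-strict
      ∣ p ℚ.* q ∣       ≡⟨ ℚ.∣p*q∣≡∣p∣*∣q∣ p q ⟩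
      ∣ p ∣ ℚ.* ∣ q ∣   ≤⟨ ℚ.*-monoʳ-≤-nonNeg ∣ q ∣ {{ℚ.∣-∣-nonNeg q}} (ℚ.<⇒≤ p<D) ⟩
      D ℚ.* ∣ q ∣       <⟨ ℚ.*-monoʳ-<-pos D {{ℚ.positive D>0}} q<δ ⟩
      D ℚ.* δ           ∎
      where open ℚ.≤-Reasoning

    product-close : ∀ a b c d {B C δ} → 0ℚ ℚ.< B → 0ℚ ℚ.< C →
      ∣ a ∣ ℚ.< B → ∣ d ∣ ℚ.< C → ∣ a ℚ.- c ∣ ℚ.< δ → ∣ b ℚ.- d ∣ ℚ.< δ →
      ∣ a ℚ.* b ℚ.- c ℚ.* d ∣ ℚ.< (B ℚ.+ C) ℚ.* δ
    product-close a b c d {B} {C} {δ} B>0 C>0 a<B d<C ac bd = begin-strict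
      ∣ a ℚ.* b ℚ.- c ℚ.* d ∣
        ≡⟨ cong ∣_∣ (regroup a b c d) ⟩
      ∣ a ℚ.* (b ℚ.- d) ℚ.+ d ℚ.* (a ℚ.- c) ∣
        ≤⟨ ℚ.∣p+q∣≤∣p∣+∣q∣ (a ℚ.* (b ℚ.- d)) (d ℚ.* (a ℚ.- c)) ⟩
      ∣ a ℚ.* (b ℚ.- d) ∣ ℚ.+ ∣ d ℚ.* (a ℚ.- c) ∣
        <⟨ ℚ.+-mono-< (product-bound a (b ℚ.- d) {B} {δ} B>0 a<B bd)
                      (product-bound d (a ℚ.- c) {C} {δ} C>0 d<C ac) ⟩
      B ℚ.* δ ℚ.+ C ℚ.* δ
        ≡⟨ ℚ.*-distribʳ-+ δ B C ⟨
      (B ℚ.+ C) ℚ.* δ ∎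
      where
      open ℚ.≤-Reasoning
      regroup : ∀ a b c d → a ℚ.* b ℚ.- c ℚ.* d ≡ a ℚ.* (b ℚ.- d) ℚ.+ d ℚ.* (a ℚ.- c)
      regroup = solve 4 (λ a b c d → a :* b :- c :* d := a :* (b :- d) :+ d :* (a :- c)) refl
        where open +-*-Solver

    *-cauchy : ∀ x y → IsCauchy x → IsCauchy y → IsCauchy (λ n → x n ℚ.* y n)
    *-cauchy x y cx cy ε ε>0 =
      let (B , B>0 , N₁ , bx) = bounded cx
          (C , C>0 , N₂ , by) = bounded cy
          (δ , δ>0 , total)   = scale (ℚ.+-mono-< B>0 C>0) ε>0
          (N₃ , hx)           = cx δ δ>0
          (N₄ , hy)           = cy δ δ>0
      in (N₁ ℕ.⊔ N₂) ℕ.⊔ (N₃ ℕ.⊔ N₄) , λ m n Nm Nn →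
        let m₁₂ = ℕ.m⊔n≤o⇒m≤o (N₁ ℕ.⊔ N₂) (N₃ ℕ.⊔ N₄) Nm
            m₃₄ = ℕ.m⊔n≤o⇒n≤o (N₁ ℕ.⊔ N₂) (N₃ ℕ.⊔ N₄) Nm
            n₁₂ = ℕ.m⊔n≤o⇒m≤o (N₁ ℕ.⊔ N₂) (N₃ ℕ.⊔ N₄) Nn
            n₃₄ = ℕ.m⊔n≤o⇒n≤o (N₁ ℕ.⊔ N₂) (N₃ ℕ.⊔ N₄) Nn
        in subst (∣ x m ℚ.* y m ℚ.- x n ℚ.* y n ∣ ℚ.<_) total
             (product-close (x m) (y m) (x n) (y n) B>0 C>0
               (bx m (ℕ.m⊔n≤o⇒m≤o N₁ N₂ m₁₂))
               (by n (ℕ.m⊔n≤o⇒n≤o N₁ N₂ n₁₂))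
               (hx m n (ℕ.m⊔n≤o⇒m≤o N₃ N₄ m₃₄) (ℕ.m⊔n≤o⇒m≤o N₃ N₄ n₃₄))
               (hy m n (ℕ.m⊔n≤o⇒n≤o N₃ N₄ m₃₄) (ℕ.m⊔n≤o⇒n≤o N₃ N₄ n₃₄)))

fromℚ : ℚ → ℝ
fromℚ q = mkℝ (λ _ → q) (const-cauchy q)

0ℝ 1ℝ : ℝ
0ℝ = fromℚ 0ℚ
1ℝ = fromℚ 1ℚ

_+_ _*_ : ℝ → ℝ → ℝ
x + y = mkℝ (λ n → seq x n ℚ.+ seq y n) (+-cauchy (seq x) (seq y) (cauchy x) (cauchy y))
x * y = mkℝ (λ n → seq x n ℚ.* seq y n) (*-cauchy (seq x) (seq y) (cauchy x) (cauchy y))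

-_ : ℝ → ℝ
- x = mkℝ (λ n → ℚ.- seq x n) (neg-cauchy (seq x) (cauchy x))

_-_ : ℝ → ℝ → ℝ
x - y = x + - y

ℝ-rawRing : RawRing 0ℓ 0ℓ
ℝ-rawRing = record
  { Carrier = ℝ ; _≈_ = _≈_ ; _+_ = _+_ ; _*_ = _*_ ; -_ = -_ ; 0# = 0ℝ ; 1# = 1ℝ }

record ℂ : Set where
  constructor _+i_
  field
    re im : ℝ

open ℂ public

infix 4 _≈ℂ_

_≈ℂ_ : ℂ → ℂ → Set
z ≈ℂ w = re z ≈ re w × im z ≈ im w

fromℝ : ℝ → ℂ
fromℝ x = x +i 0ℝ

ℂ-rawRing : RawRing 0ℓ 0ℓ
ℂ-rawRing = record
  { Carrier = ℂ
  ; _≈_     = _≈ℂ_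
  ; _+_     = λ z w → (re z + re w) +i (im z + im w)
  ; _*_     = λ z w → (re z * re w - im z * im w) +i (re z * im w + im z * re w)
  ; -_      = λ z → (- re z) +i (- im z)
  ; 0#      = fromℝ 0ℝ
  ; 1#      = fromℝ 1ℝ
  }

-- The vector c₀ ∷ … ∷ c_{d-1} ∷ [] stands for the monic polynomial
-- c₀ + c₁ X + … + c_{d-1} X^{d-1} + X^d of degree d.
Monic : Set → ℕ → Set
Monic = Vec

module _ {c ℓ} (R : RawRing c ℓ) where
  private module R = RawRing R

  eval : ∀ {A d} → (A → R.Carrier) → Monic A d → R.Carrier → R.Carrier
  eval ι []      x = R.1#
  eval ι (c ∷ p) x = ι c R.+ x R.* eval ι p x

  Root : ∀ {A d} → (A → R.Carrier) → Monic A d → R.Carrier → Set ℓ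
  Root ι p x = eval ι p x R.≈ R.0#

fromℤ : ℤ → ℝ
fromℤ k = fromℚ (k ℚ./ 1)

IsAlgebraicInteger : ℝ → Set
IsAlgebraicInteger a = ∃[ d ] Σ[ p ∈ Monic ℤ d ] Root ℝ-rawRing fromℤ p a

-- The minimal polynomial over ℚ: the monic rational polynomial of least
-- degree that vanishes at a.
record IsMinimalPolynomial {d} (μ : Monic ℚ d) (a : ℝ) : Set where
  field
    root    : Root ℝ-rawRing fromℚ μ a
    minimal : ∀ {e} (q : Monic ℚ e) → Root ℝ-rawRing fromℚ q a → d ℕ.≤ e

_IsConjugateOf_ : ℂ → ℝ → Set
z IsConjugateOf a = ∃[ d ] Σ[ μ ∈ Monic ℚ d ]
  IsMinimalPolynomial μ a × Root ℂ-rawRing (λ q → fromℝ (fromℚ q)) μ z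

IsTotallyReal : ℝ → Set
IsTotallyReal a = ∀ z → z IsConjugateOf a → im z ≈ 0ℝ

IsConvex : ℝ → ∀ {ℓ} → Pred ℝ ℓ → Set ℓ
IsConvex a V = ∀ {x y} → x ∈ V → y ∈ V → a * x + (1ℝ - a) * y ∈ V

-- Subsets of ℝ are the predicates respecting _≈_, hence the side
-- condition on the sets W being intersected.
ConvexHull : ℝ → ∀ {ℓ} → Pred ℝ ℓ → Pred ℝ (lsuc 0ℓ ⊔ ℓ)
ConvexHull a V x = ∀ (W : Pred ℝ 0ℓ) → W Respects _≈_ → IsConvex a W → V ⊆ W → x ∈ W

D : ℝ → Pred ℝ (lsuc 0ℓ)
D a = ConvexHull a (λ x → x ≈ 0ℝ ⊎ x ≈ 1ℝ)

IsLimitPoint : ∀ {ℓ} → Pred ℝ ℓ → ℝ → Set ℓ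
IsLimitPoint V x = ∀ ε → 0ℝ < ε →
  ∃[ v ] v ∈ V × ¬ (v ≈ x) × x - ε < v × v < x + ε

IsSparse : ℝ → Set (lsuc 0ℓ)
IsSparse a = ¬ ∃ (IsLimitPoint (D a))

_∈⟨0,1⟩ : ℂ → Set
z ∈⟨0,1⟩ = ∃[ t ] 0ℝ < t × t < 1ℝ × z ≈ℂ fromℝ t

{-# OPTIONS --safe #-}

-- Write b for the conjugate, and suppose b > 1 (if b < 0, pass to 1 - a and
-- 1 - b, which changes neither the hull nor the hypothesis).  The differences
-- of two points of D(a) form an a-convex symmetric set Δ, and a(1-a)(δ+η) ∈ Δ
-- for δ, η ∈ Δ.  Hence, for a suitable constant κ depending on j, Δ contains κ
-- times every Horner sum Σ eᵢ aⁱ with integer digits |eᵢ| ≤ j.  Choosing the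
-- digits by rounding gives a sequence sₙ₊₁ = a sₙ + eₙ with |sₙ| ≤ 2, whose
-- conjugates tₙ₊₁ = b tₙ + eₙ increase by at least 1 at every step, provided t₀
-- is large; the start s₀ = d a + e₀ has t₀ = d (b - a) + s₀, with d at our
-- disposal because b ≠ a.  By the pigeonhole principle two sₙ are arbitrarily
-- close, but they are distinct because the tₙ are.  So Δ contains a nonzero
-- δ = x - y with |δ| ≤ 1/2, and iterating t ↦ t x + (1-t) y on 0 and 1 stays in
-- D(a) and converges to y / (1 - δ), which is therefore a limit point.
module Submission where

open import Defs
open import Data.Empty using (⊥; ⊥-elim)
open import Data.Fin.Base using (toℕ; fromℕ<)
open import Data.Fin.Properties using (pigeonhole; toℕ-fromℕ<)
import Data.Integer.Base as ℤ
import Data.Integer.Properties as ℤ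
open import Data.Nat.Base as ℕ using (ℕ; zero; suc)
import Data.Nat.Properties as ℕ
open import Data.Product.Base using (_×_; _,_; ∃; ∃₂; ∃-syntax; Σ-syntax; proj₁; proj₂)
open import Data.Rational.Base as ℚ using (ℚ; mkℚ; 0ℚ; 1ℚ; ½; ∣_∣)
import Data.Rational.Properties as ℚ
open import Data.Rational.Solver using (module +-*-Solver)
import Data.Rational.Unnormalised.Base as ℚᵘ
import Data.Rational.Unnormalised.Properties as ℚᵘ
open import Data.Sum.Base using (_⊎_; inj₁; inj₂)
open import Data.Vec.Base using (Vec; []; _∷_; map; zipWith; replicate)
open import Level using (0ℓ)
open import Relation.Binary.Definitions using (_Respects_)
open import Relation.Binary.PropositionalEquality
  using (_≡_; refl; sym; trans; cong; cong₂; subst; subst₂; module ≡-Reasoning)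
open import Relation.Nullary.Decidable using (yes; no)
open import Relation.Nullary.Negation using (¬_; contradiction)
open import Relation.Unary using (Pred)
open +-*-Solver using (solve; _:+_; _:*_; _:-_; :-_; _:=_; con)

-- Rational arithmetic

2ℚ : ℚ
2ℚ = 1ℚ ℚ.+ 1ℚ

0<1 : 0ℚ ℚ.< 1ℚ
0<1 = ℚ.positive⁻¹ 1ℚ

0<½ : 0ℚ ℚ.< ½
0<½ = ℚ.positive⁻¹ ½

0<2 : 0ℚ ℚ.< 2ℚ
0<2 = ℚ.positive⁻¹ 2ℚ

0≤+ : ∀ {p q} → 0ℚ ℚ.≤ p → 0ℚ ℚ.≤ q → 0ℚ ℚ.≤ p ℚ.+ q
0≤+ = ℚ.+-mono-≤

0≤* : ∀ {p q} → 0ℚ ℚ.≤ p → 0ℚ ℚ.≤ q → 0ℚ ℚ.≤ p ℚ.* q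
0≤* {p} {q} 0≤p 0≤q = subst (ℚ._≤ p ℚ.* q) (ℚ.*-zeroʳ p)
  (ℚ.*-monoˡ-≤-nonNeg p {{ℚ.nonNegative 0≤p}} 0≤q)

0<+ : ∀ {p q} → 0ℚ ℚ.< p → 0ℚ ℚ.≤ q → 0ℚ ℚ.< p ℚ.+ q
0<+ = ℚ.+-mono-<-≤

0<* : ∀ {p q} → 0ℚ ℚ.< p → 0ℚ ℚ.< q → 0ℚ ℚ.< p ℚ.* q
0<* {p} {q} 0<p 0<q = subst (ℚ._< p ℚ.* q) (ℚ.*-zeroʳ p)
  (ℚ.*-monoʳ-<-pos p {{ℚ.positive 0<p}} 0<q)

p≤q⇒0≤q-p : ∀ {p q} → p ℚ.≤ q → 0ℚ ℚ.≤ q ℚ.- p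
p≤q⇒0≤q-p {p} {q} p≤q = subst (ℚ._≤ q ℚ.- p) (ℚ.+-inverseʳ p) (ℚ.+-monoˡ-≤ (ℚ.- p) p≤q)

p<q⇒0<q-p : ∀ {p q} → p ℚ.< q → 0ℚ ℚ.< q ℚ.- p
p<q⇒0<q-p {p} {q} p<q = subst (ℚ._< q ℚ.- p) (ℚ.+-inverseʳ p) (ℚ.+-monoˡ-< (ℚ.- p) p<q)

-- Linear arithmetic: p ≤ q is proved by exhibiting q - p as a sum of
-- products of nonnegative terms, the identity being left to the ring solver.
≤-by : ∀ {p q} r → 0ℚ ℚ.≤ r → q ≡ p ℚ.+ r → p ℚ.≤ q
≤-by {p} r 0≤r refl = subst (ℚ._≤ p ℚ.+ r) (ℚ.+-identityʳ p) (ℚ.+-monoʳ-≤ p 0≤r)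

<-by : ∀ {p q} r → 0ℚ ℚ.< r → q ≡ p ℚ.+ r → p ℚ.< q
<-by {p} r 0<r refl = subst (ℚ._< p ℚ.+ r) (ℚ.+-identityʳ p) (ℚ.+-monoʳ-< p 0<r)

p≤∣p∣ : ∀ p → p ℚ.≤ ∣ p ∣
p≤∣p∣ p with ℚ.≤-total 0ℚ p
... | inj₁ 0≤p = ℚ.≤-reflexive (sym (ℚ.0≤p⇒∣p∣≡p 0≤p))
... | inj₂ p≤0 = ℚ.≤-trans p≤0 (ℚ.0≤∣p∣ p)

-p≤∣p∣ : ∀ p → ℚ.- p ℚ.≤ ∣ p ∣
-p≤∣p∣ p = subst (ℚ.- p ℚ.≤_) (ℚ.∣-p∣≡∣p∣ p) (p≤∣p∣ (ℚ.- p))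

∣p∣≤ : ∀ {p r} → p ℚ.≤ r → ℚ.- p ℚ.≤ r → ∣ p ∣ ℚ.≤ r
∣p∣≤ {p} p≤r -p≤r with ℚ.∣p∣≡p∨∣p∣≡-p p
... | inj₁ e = subst (ℚ._≤ _) (sym e) p≤r
... | inj₂ e = subst (ℚ._≤ _) (sym e) -p≤r

∣p-q∣≡∣q-p∣ : ∀ p q → ∣ p ℚ.- q ∣ ≡ ∣ q ℚ.- p ∣
∣p-q∣≡∣q-p∣ p q = trans (sym (ℚ.∣-p∣≡∣p∣ (p ℚ.- q)))
  (cong ∣_∣ (solve 2 (λ p q → :- (p :- q) := q :- p) refl p q))

∣p-p∣≡0 : ∀ p → ∣ p ℚ.- p ∣ ≡ 0ℚ
∣p-p∣≡0 p = cong ∣_∣ (ℚ.+-inverseʳ p)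

∣*∣≤ : ∀ p q {r s} → ∣ p ∣ ℚ.≤ r → ∣ q ∣ ℚ.≤ s → ∣ p ℚ.* q ∣ ℚ.≤ r ℚ.* s
∣*∣≤ p q {r} {s} p≤r q≤s = subst (ℚ._≤ r ℚ.* s) (sym (ℚ.∣p*q∣≡∣p∣*∣q∣ p q))
  (≤-by (∣ p ∣ ℚ.* (s ℚ.- ∣ q ∣) ℚ.+ (r ℚ.- ∣ p ∣) ℚ.* s)
    (0≤+ (0≤* (ℚ.0≤∣p∣ p) (p≤q⇒0≤q-p q≤s))
         (0≤* (p≤q⇒0≤q-p p≤r) (ℚ.≤-trans (ℚ.0≤∣p∣ q) q≤s)))
    (solve 4 (λ p q r s → r :* s := p :* q :+ (p :* (s :- q) :+ (r :- p) :* s)) refl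
       ∣ p ∣ ∣ q ∣ r s))

∣+∣≤ : ∀ p q {r s} → ∣ p ∣ ℚ.≤ r → ∣ q ∣ ℚ.≤ s → ∣ p ℚ.+ q ∣ ℚ.≤ r ℚ.+ s
∣+∣≤ p q p≤r q≤s = ℚ.≤-trans (ℚ.∣p+q∣≤∣p∣+∣q∣ p q) (ℚ.+-mono-≤ p≤r q≤s)

∣-∣≤ : ∀ p q {r s} → ∣ p ∣ ℚ.≤ r → ∣ q ∣ ℚ.≤ s → ∣ p ℚ.- q ∣ ℚ.≤ r ℚ.+ s
∣-∣≤ p q p≤r q≤s = ℚ.≤-trans (ℚ.∣p-q∣≤∣p∣+∣q∣ p q) (ℚ.+-mono-≤ p≤r q≤s)

quotient : ∀ {s ε} → 0ℚ ℚ.< s → 0ℚ ℚ.< ε → ∃[ δ ] 0ℚ ℚ.< δ × s ℚ.* δ ≡ ε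
quotient {s} {ε} 0<s 0<ε = s⁻¹ ℚ.* ε
  , 0<* (ℚ.positive⁻¹ s⁻¹ {{ℚ.1/pos⇒pos s {{s-pos}}}}) 0<ε
  , trans (sym (ℚ.*-assoc s s⁻¹ ε))
      (trans (cong (ℚ._* ε) (ℚ.*-inverseʳ s {{s≢0}})) (ℚ.*-identityˡ ε))
  where
  s-pos : ℚ.Positive s
  s-pos = ℚ.positive 0<s
  s≢0 : ℚ.NonZero s
  s≢0 = ℚ.pos⇒nonZero s {{s-pos}}
  s⁻¹ : ℚ
  s⁻¹ = (ℚ.1/ s) {{s≢0}}

-- Recursion, instead of the fraction n/1, makes `ι (suc n)` unfold to a sum that the ring solver
-- can treat.
ι : ℕ → ℚ
ι zero    = 0ℚ
ι (suc n) = 1ℚ ℚ.+ ι n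

0≤ι : ∀ n → 0ℚ ℚ.≤ ι n
0≤ι zero    = ℚ.≤-refl
0≤ι (suc n) = 0≤+ (ℚ.<⇒≤ 0<1) (0≤ι n)

ι-+ : ∀ m n → ι (m ℕ.+ n) ≡ ι m ℚ.+ ι n
ι-+ zero    n = sym (ℚ.+-identityˡ (ι n))
ι-+ (suc m) n = trans (cong (1ℚ ℚ.+_) (ι-+ m n)) (sym (ℚ.+-assoc 1ℚ (ι m) (ι n)))

toℚᵘ-ι : ∀ n → ℚ.toℚᵘ (ι n) ℚᵘ.≃ ℚᵘ.mkℚᵘ (ℤ.+ n) 0
toℚᵘ-ι zero    = ℚᵘ.*≡* refl
toℚᵘ-ι (suc n) = ℚᵘ.≃-trans (ℚ.toℚᵘ-homo-+ 1ℚ (ι n))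
  (ℚᵘ.≃-trans (ℚᵘ.+-congʳ ℚᵘ.1ℚᵘ (toℚᵘ-ι n))
    (ℚᵘ.*≡* (cong (λ k → (ℤ.+ 1 ℤ.+ k) ℤ.* ℤ.+ 1) (ℤ.*-identityʳ (ℤ.+ n)))))

-- The absolute value of the numerator will do, since the denominator is at least 1.
archimedes : ∀ q → ∃[ n ] q ℚ.≤ ι n
archimedes q@(mkℚ k d-1 _) = ℤ.∣ k ∣ , ℚ.toℚᵘ-cancel-≤
  (ℚᵘ.≤-trans (ℚᵘ.*≤* k≤∣k∣d) (ℚᵘ.≤-reflexive (ℚᵘ.≃-sym (toℚᵘ-ι ℤ.∣ k ∣))))
  where
  i≤∣i∣ : ∀ i → i ℤ.≤ ℤ.+ ℤ.∣ i ∣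
  i≤∣i∣ (ℤ.+ n)     = ℤ.≤-refl
  i≤∣i∣ (ℤ.-[1+ n ]) = ℤ.-≤+
  k≤∣k∣d : k ℤ.* ℤ.+ 1 ℤ.≤ ℤ.+ ℤ.∣ k ∣ ℤ.* ℤ.+ suc d-1
  k≤∣k∣d = subst₂ ℤ._≤_ (sym (ℤ.*-identityʳ k)) (ℤ.pos-* ℤ.∣ k ∣ (suc d-1))
    (ℤ.≤-trans (i≤∣i∣ k) (ℤ.+≤+ (ℕ.m≤m*n ℤ.∣ k ∣ (suc d-1))))

-- The search descends from `N`: as soon as `q` exceeds `ι N`, the bound `q ≤ 1 + ι N` puts `N`
-- within 1 of `q`.
round : ∀ N {q} → 0ℚ ℚ.≤ q → q ℚ.≤ ι N → ∃[ m ] m ℕ.≤ N × ∣ q ℚ.- ι m ∣ ℚ.≤ 1ℚ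
round zero {q} 0≤q q≤0 = 0 , ℕ.≤-refl , subst (ℚ._≤ 1ℚ)
  (sym (trans (cong (λ t → ∣ t ℚ.- 0ℚ ∣) (ℚ.≤-antisym q≤0 0≤q)) (∣p-p∣≡0 0ℚ))) (ℚ.<⇒≤ 0<1)
round (suc N) {q} 0≤q q≤1+N with q ℚ.≤? ι N
... | yes q≤N with round N 0≤q q≤N
...   | m , m≤N , h = m , ℕ.m≤n⇒m≤1+n m≤N , h
round (suc N) {q} 0≤q q≤1+N | no q≰N = N , ℕ.n≤1+n N , ∣p∣≤
  (≤-by _ (p≤q⇒0≤q-p q≤1+N) (solve 2 (λ q n → con 1ℚ := (q :- n) :+ ((con 1ℚ :+ n) :- q)) refl q (ι N)))
  (ℚ.≤-trans (≤-by _ (p≤q⇒0≤q-p (ℚ.<⇒≤ (ℚ.≰⇒> q≰N)))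
      (solve 2 (λ q n → con 0ℚ := :- (q :- n) :+ (q :- n)) refl q (ι N))) (ℚ.<⇒≤ 0<1))

-- Real numbers

Eventually : (ℕ → Set) → Set
Eventually P = ∃[ N ] ∀ n → N ℕ.≤ n → P n

ev-always : ∀ {P} → (∀ n → P n) → Eventually P
ev-always p = 0 , λ n _ → p n

ev-map : ∀ {P Q} → (∀ n → P n → Q n) → Eventually P → Eventually Q
ev-map f (N , h) = N , λ n N≤n → f n (h n N≤n)

ev-zip : ∀ {P Q R} → (∀ n → P n → Q n → R n) → Eventually P → Eventually Q → Eventually R
ev-zip f (N , h) (M , g) = N ℕ.⊔ M , λ n ≤n →
  f n (h n (ℕ.m⊔n≤o⇒m≤o N M ≤n)) (g n (ℕ.m⊔n≤o⇒n≤o N M ≤n))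

ev-now : ∀ {P} → Eventually P → ∃ P
ev-now (N , h) = N , h N ℕ.≤-refl

-- The relations below unfold to statements about sequences from which
-- Agda cannot recover the reals involved; hence the record wrappers.
infix 4 _≃_
record _≃_ (x y : ℝ) : Set where
  constructor equal
  field
    close : x ≈ y

record Bound (x : ℝ) (r : ℚ) : Set where
  constructor bound
  field
    below : Eventually λ n → ∣ seq x n ∣ ℚ.≤ r

record AtLeast (r : ℚ) (x : ℝ) : Set where
  constructor atLeast
  field
    above : Eventually λ n → r ℚ.≤ seq x n

record Apart₀ (x : ℝ) : Set where
  constructor apart
  field
    {radius} : ℚ
    positive : 0ℚ ℚ.< radius
    away     : Eventually λ n → radius ℚ.≤ ∣ seq x n ∣

open _≃_ public
open Bound public
open AtLeast public

bounded : ∀ x → ∃[ B ] 0ℚ ℚ.< B × Bound x B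
bounded x with cauchy x 1ℚ 0<1
... | N , h = ∣ seq x N ∣ ℚ.+ 1ℚ , ℚ.+-mono-≤-< (ℚ.0≤∣p∣ (seq x N)) 0<1 , bound (N , λ n N≤n →
  subst (ℚ._≤ ∣ seq x N ∣ ℚ.+ 1ℚ)
    (cong ∣_∣ (solve 2 (λ a b → b :+ (a :- b) := a) refl (seq x n) (seq x N)))
    (∣+∣≤ (seq x N) (seq x n ℚ.- seq x N) ℚ.≤-refl (ℚ.<⇒≤ (h n N N≤n ℕ.≤-refl))))

settle : ∀ x {r} → 0ℚ ℚ.< r →
  ∃[ N ] ∀ n → N ℕ.≤ n → ∣ seq x n ℚ.- seq x N ∣ ℚ.≤ r
settle x 0<r with cauchy x _ 0<r
... | N , h = N , λ n N≤n → ℚ.<⇒≤ (h n N N≤n ℕ.≤-refl)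

-- Constants cost nothing: the hypothesis at `ε / (K + 1)` leaves a margin that also makes the
-- inequality strict.
≃-intro : ∀ {x y K} → 0ℚ ℚ.< K →
  (∀ ε → 0ℚ ℚ.< ε → Eventually λ n → ∣ seq x n ℚ.- seq y n ∣ ℚ.≤ K ℚ.* ε) → x ≃ y
≃-intro {x} {y} {K} 0<K h = equal conclude
  where
  conclude : x ≈ y
  conclude ε 0<ε with quotient (0<+ 0<K (ℚ.<⇒≤ 0<1)) 0<ε
  ... | δ , 0<δ , refl = ev-map
    (λ n le → ℚ.≤-<-trans le
      (<-by δ 0<δ (solve 2 (λ k d → (k :+ con 1ℚ) :* d := k :* d :+ d) refl K δ)))
    (h δ 0<δ)

≃-eventually : ∀ {x y} → Eventually (λ n → seq x n ≡ seq y n) → x ≃ y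
≃-eventually {x} {y} e = equal λ ε 0<ε → ev-map (λ n e →
  subst (ℚ._< ε) (sym (trans (cong (λ t → ∣ t ℚ.- seq y n ∣) e) (∣p-p∣≡0 (seq y n)))) 0<ε) e

≃-pointwise : ∀ {x y} → (∀ n → seq x n ≡ seq y n) → x ≃ y
≃-pointwise {x} {y} e = ≃-eventually {x} {y} (ev-always e)

≃-refl : ∀ {x} → x ≃ x
≃-refl {x} = ≃-pointwise {x} {x} λ _ → refl

≃-sym : ∀ {x y} → x ≃ y → y ≃ x
≃-sym {x} {y} (equal e) = equal λ ε 0<ε →
  ev-map (λ n → subst (ℚ._< ε) (∣p-q∣≡∣q-p∣ (seq x n) (seq y n))) (e ε 0<ε)

≃-trans : ∀ {x y z} → x ≃ y → y ≃ z → x ≃ z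
≃-trans {x} {y} {z} (equal e) (equal f) = ≃-intro 0<2 λ ε 0<ε →
  ev-zip (λ n p q → subst₂ ℚ._≤_
      (cong ∣_∣ (solve 3 (λ x y z → (x :- y) :+ (y :- z) := x :- z) refl (seq x n) (seq y n) (seq z n)))
      (solve 1 (λ e → e :+ e := con 2ℚ :* e) refl ε)
      (∣+∣≤ (seq x n ℚ.- seq y n) (seq y n ℚ.- seq z n) (ℚ.<⇒≤ p) (ℚ.<⇒≤ q)))
    (e ε 0<ε) (f ε 0<ε)

+-cong : ∀ {x x′ y y′} → x ≃ x′ → y ≃ y′ → x + y ≃ x′ + y′
+-cong {x} {x′} {y} {y′} (equal e) (equal f) = ≃-intro 0<2 λ ε 0<ε →
  ev-zip (λ n p q → subst₂ ℚ._≤_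
      (cong ∣_∣ (solve 4 (λ x x′ y y′ → (x :- x′) :+ (y :- y′) := (x :+ y) :- (x′ :+ y′)) refl
        (seq x n) (seq x′ n) (seq y n) (seq y′ n)))
      (solve 1 (λ e → e :+ e := con 2ℚ :* e) refl ε)
      (∣+∣≤ (seq x n ℚ.- seq x′ n) (seq y n ℚ.- seq y′ n) (ℚ.<⇒≤ p) (ℚ.<⇒≤ q)))
    (e ε 0<ε) (f ε 0<ε)

*-congˡ : ∀ x {y y′} → y ≃ y′ → x * y ≃ x * y′
*-congˡ x {y} {y′} (equal e) = let (B , 0<B , bound x≤B) = bounded x in ≃-intro 0<B λ ε 0<ε →
  ev-zip (λ n p q → subst (ℚ._≤ B ℚ.* ε)
      (cong ∣_∣ (solve 3 (λ x y y′ → x :* (y :- y′) := x :* y :- x :* y′) refl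
        (seq x n) (seq y n) (seq y′ n)))
      (∣*∣≤ (seq x n) (seq y n ℚ.- seq y′ n) p (ℚ.<⇒≤ q)))
    x≤B (e ε 0<ε)

*-comm : ∀ x y → x * y ≃ y * x
*-comm x y = ≃-pointwise λ n → ℚ.*-comm (seq x n) (seq y n)

*-congʳ : ∀ {x x′} y → x ≃ x′ → x * y ≃ x′ * y
*-congʳ {x} {x′} y e = ≃-trans (*-comm x y) (≃-trans (*-congˡ y e) (*-comm y x′))

neg-cong : ∀ {x y} → x ≃ y → - x ≃ - y
neg-cong {x} {y} (equal e) = equal λ ε 0<ε → ev-map (λ n → subst (ℚ._< ε)
  (trans (∣p-q∣≡∣q-p∣ (seq x n) (seq y n)) (cong ∣_∣
    (solve 2 (λ x y → y :- x := :- x :- :- y) refl (seq x n) (seq y n))))) (e ε 0<ε)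

minus-cong : ∀ {x x′ y y′} → x ≃ x′ → y ≃ y′ → x - y ≃ x′ - y′
minus-cong e f = +-cong e (neg-cong f)

-- Equal reals may have different sequences, so a bound is transferred with a margin; `s - r`
-- absorbs the eventual discrepancy.
bound-resp : ∀ {x y r s} → x ≃ y → r ℚ.< s → Bound x r → Bound y s
bound-resp {x} {y} {r} {s} (equal e) r<s (bound b) = bound (ev-zip (λ n p q → subst₂ ℚ._≤_
    (cong ∣_∣ (solve 2 (λ x y → x :+ (y :- x) := y) refl (seq x n) (seq y n)))
    (solve 2 (λ r s → r :+ (s :- r) := s) refl r s)
    (∣+∣≤ (seq x n) (seq y n ℚ.- seq x n) q
      (ℚ.<⇒≤ (subst (ℚ._< s ℚ.- r) (∣p-q∣≡∣q-p∣ (seq x n) (seq y n)) p))))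
  (e _ (p<q⇒0<q-p r<s)) b)

bound-weaken : ∀ {x r s} → r ℚ.≤ s → Bound x r → Bound x s
bound-weaken r≤s (bound b) = bound (ev-map (λ n p → ℚ.≤-trans p r≤s) b)

bound-* : ∀ {x y r s} → Bound x r → Bound y s → Bound (x * y) (r ℚ.* s)
bound-* {x} {y} (bound p) (bound q) = bound (ev-zip (λ n → ∣*∣≤ (seq x n) (seq y n)) p q)

apart⇒≄0 : ∀ {x} → Apart₀ x → ¬ (x ≃ 0ℝ)
apart⇒≄0 {x} (apart {ρ} 0<ρ h) (equal e) with ev-now (ev-zip (λ n → _,_) h (e ρ 0<ρ))
... | n , ρ≤x , x<ρ = ℚ.<-irrefl refl (ℚ.≤-<-trans ρ≤x
  (subst (ℚ._< ρ) (cong ∣_∣ (solve 1 (λ x → x :- con 0ℚ := x) refl (seq x n))) x<ρ))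

-- The test `∣ seq x N ∣ ≤ 2 ε` is decidable on rationals, where `x` varies by at most `ε` after
-- `N`. A failed test would keep the tail at distance `ε` from 0, against the hypothesis.
¬apart⇒≃0 : ∀ {x} → ¬ Apart₀ x → x ≃ 0ℝ
¬apart⇒≃0 {x} ¬apart = ≃-intro {K = 2ℚ ℚ.+ 1ℚ} (0<+ 0<2 (ℚ.<⇒≤ 0<1)) small
  where
  small : ∀ ε → 0ℚ ℚ.< ε → Eventually λ n → ∣ seq x n ℚ.- 0ℚ ∣ ℚ.≤ (2ℚ ℚ.+ 1ℚ) ℚ.* ε
  small ε 0<ε with settle x 0<ε
  ... | N , h with ∣ seq x N ∣ ℚ.≤? 2ℚ ℚ.* ε
  ...   | yes le = N , λ n N≤n → subst₂ ℚ._≤_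
    (cong ∣_∣ (solve 2 (λ x y → y :+ (x :- y) := x :- con 0ℚ) refl (seq x n) (seq x N)))
    (solve 1 (λ e → con 2ℚ :* e :+ e := (con 2ℚ :+ con 1ℚ) :* e) refl ε)
    (∣+∣≤ (seq x N) (seq x n ℚ.- seq x N) le (h n N≤n))
  ...   | no gt = ⊥-elim (¬apart (apart 0<ε (N , λ n N≤n → ≤-by _
    (0≤+ (p≤q⇒0≤q-p (ℚ.<⇒≤ (ℚ.≰⇒> gt))) (p≤q⇒0≤q-p (xN≤ n N≤n)))
    (solve 3 (λ e X x → x := e :+ ((X :- con 2ℚ :* e) :+ ((e :+ x) :- X))) refl
       ε ∣ seq x N ∣ ∣ seq x n ∣))))
    where
    xN≤ : ∀ n → N ℕ.≤ n → ∣ seq x N ∣ ℚ.≤ ε ℚ.+ ∣ seq x n ∣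
    xN≤ n N≤n = subst (ℚ._≤ ε ℚ.+ ∣ seq x n ∣)
      (cong ∣_∣ (solve 2 (λ x y → (y :- x) :+ x := y) refl (seq x n) (seq x N)))
      (∣+∣≤ (seq x N ℚ.- seq x n) (seq x n)
        (subst (ℚ._≤ ε) (∣p-q∣≡∣q-p∣ (seq x n) (seq x N)) (h n N≤n)) ℚ.≤-refl)

apart-cancel : ∀ {x y} → Apart₀ y → x * y ≃ 0ℝ → x ≃ 0ℝ
apart-cancel {x} {y} (apart {ρ} 0<ρ h) (equal e) = equal λ ε 0<ε → ev-zip (λ n ρ≤y xy< →
    ℚ.*-cancelʳ-<-nonNeg ρ {{ℚ.pos⇒nonNeg ρ {{ℚ.positive 0<ρ}}}} (ℚ.≤-<-trans
      (≤-by {q = ∣ seq x n ∣ ℚ.* ∣ seq y n ∣}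
        (∣ seq x n ∣ ℚ.* (∣ seq y n ∣ ℚ.- ρ))
        (0≤* (ℚ.0≤∣p∣ (seq x n)) (p≤q⇒0≤q-p ρ≤y))
        (trans (solve 3 (λ x y r → x :* y := x :* r :+ x :* (y :- r)) refl
                 ∣ seq x n ∣ ∣ seq y n ∣ ρ)
               (cong (λ t → ∣ t ∣ ℚ.* ρ ℚ.+ ∣ seq x n ∣ ℚ.* (∣ seq y n ∣ ℚ.- ρ))
                 (solve 1 (λ x → x := x :- con 0ℚ) refl (seq x n)))))
      (subst (ℚ._< ε ℚ.* ρ)
        (trans (cong ∣_∣ (solve 1 (λ x → x :- con 0ℚ := x) refl (seq x n ℚ.* seq y n)))
          (ℚ.∣p*q∣≡∣p∣*∣q∣ (seq x n) (seq y n))) xy<)))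
  h (e (ε ℚ.* ρ) (0<* 0<ε 0<ρ))

apart-* : ∀ {x y} → Apart₀ x → Apart₀ y → Apart₀ (x * y)
apart-* {x} {y} (apart {ρ} 0<ρ h) (apart {σ} 0<σ g) = apart (0<* 0<ρ 0<σ) (ev-zip (λ n ρ≤x σ≤y →
    subst (ρ ℚ.* σ ℚ.≤_) (sym (ℚ.∣p*q∣≡∣p∣*∣q∣ (seq x n) (seq y n)))
      (≤-by (ρ ℚ.* (∣ seq y n ∣ ℚ.- σ) ℚ.+ (∣ seq x n ∣ ℚ.- ρ) ℚ.* ∣ seq y n ∣)
        (0≤+ (0≤* (ℚ.<⇒≤ 0<ρ) (p≤q⇒0≤q-p σ≤y)) (0≤* (p≤q⇒0≤q-p ρ≤x) (ℚ.0≤∣p∣ (seq y n))))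
        (solve 4 (λ x y r s → x :* y := r :* s :+ (r :* (y :- s) :+ (x :- r) :* y)) refl
          ∣ seq x n ∣ ∣ seq y n ∣ ρ σ)))
  h g)

-- Were `y` apart from 0, `apart-cancel` would give `x ≃ 0ℝ`; so a factor that is merely not 0 can
-- be cancelled.
≄0-cancel : ∀ {x y} → ¬ (x ≃ 0ℝ) → x * y ≃ 0ℝ → y ≃ 0ℝ
≄0-cancel x≄0 xy≃0 = ¬apart⇒≃0 λ y#0 → x≄0 (apart-cancel y#0 xy≃0)

x-y≃0⇒x≃y : ∀ {x y} → x - y ≃ 0ℝ → x ≃ y
x-y≃0⇒x≃y {x} {y} (equal e) = equal λ ε 0<ε → ev-map (λ n → subst (ℚ._< ε) (cong ∣_∣
  (solve 2 (λ x y → (x :- y) :- con 0ℚ := x :- y) refl (seq x n) (seq y n)))) (e ε 0<ε)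

x≃y⇒x-y≃0 : ∀ {x y} → x ≃ y → x - y ≃ 0ℝ
x≃y⇒x-y≃0 {x} {y} (equal e) = equal λ ε 0<ε → ev-map (λ n → subst (ℚ._< ε) (cong ∣_∣
  (solve 2 (λ x y → x :- y := (x :- y) :- con 0ℚ) refl (seq x n) (seq y n)))) (e ε 0<ε)

atLeast⇒apart : ∀ {x ρ} → 0ℚ ℚ.< ρ → AtLeast ρ x → Apart₀ x
atLeast⇒apart {x} 0<ρ (atLeast h) = apart 0<ρ (ev-map (λ n p → ℚ.≤-trans p (p≤∣p∣ (seq x n))) h)

-- Eventually `x` is within `½ * ρ` of the rational `seq x N` and at distance at least `ρ` from 0,
-- so it keeps the sign of that rational.
apart-sign : ∀ {x} → Apart₀ x → ∃[ ρ ] 0ℚ ℚ.< ρ × (AtLeast ρ x ⊎ AtLeast ρ (- x))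
apart-sign {x} (apart {ρ} 0<ρ (M , h)) with settle x (0<* 0<½ 0<ρ)
... | N , g = ρ , 0<ρ , sign (ℚ.≤-total 0ℚ (seq x N))
  where
  ½ρ<ρ : ½ ℚ.* ρ ℚ.< ρ
  ½ρ<ρ = <-by _ (0<* 0<½ 0<ρ) (solve 1 (λ r → r := con ½ :* r :+ con ½ :* r) refl ρ)
  absurd : ∀ {p} → ρ ℚ.≤ p → p ℚ.≤ ½ ℚ.* ρ → ⊥
  absurd ρ≤p p≤½ρ = ℚ.<-irrefl refl (ℚ.<-≤-trans ½ρ<ρ (ℚ.≤-trans ρ≤p p≤½ρ))
  sign : 0ℚ ℚ.≤ seq x N ⊎ seq x N ℚ.≤ 0ℚ → AtLeast ρ x ⊎ AtLeast ρ (- x)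
  sign (inj₁ 0≤xN) = inj₁ (atLeast (ev-zip pick (N , g) (M , h)))
    where
    pick : ∀ n → ∣ seq x n ℚ.- seq x N ∣ ℚ.≤ ½ ℚ.* ρ → ρ ℚ.≤ ∣ seq x n ∣ → ρ ℚ.≤ seq x n
    pick n c ρ≤ with ℚ.∣p∣≡p∨∣p∣≡-p (seq x n)
    ... | inj₁ e = subst (ρ ℚ.≤_) e ρ≤
    ... | inj₂ e = ⊥-elim (absurd (subst (ρ ℚ.≤_) e ρ≤)
      (≤-by _ (0≤+ 0≤xN (p≤q⇒0≤q-p (ℚ.≤-trans (-p≤∣p∣ (seq x n ℚ.- seq x N)) c)))
        (solve 3 (λ x y r → r := :- x :+ (y :+ (r :- :- (x :- y)))) refl
          (seq x n) (seq x N) (½ ℚ.* ρ))))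
  sign (inj₂ xN≤0) = inj₂ (atLeast (ev-zip pick (N , g) (M , h)))
    where
    pick : ∀ n → ∣ seq x n ℚ.- seq x N ∣ ℚ.≤ ½ ℚ.* ρ → ρ ℚ.≤ ∣ seq x n ∣ → ρ ℚ.≤ ℚ.- seq x n
    pick n c ρ≤ with ℚ.∣p∣≡p∨∣p∣≡-p (seq x n)
    ... | inj₂ e = subst (ρ ℚ.≤_) e ρ≤
    ... | inj₁ e = ⊥-elim (absurd (subst (ρ ℚ.≤_) e ρ≤)
      (≤-by _ (0≤+ (p≤q⇒0≤q-p xN≤0) (p≤q⇒0≤q-p (ℚ.≤-trans (p≤∣p∣ (seq x n ℚ.- seq x N)) c)))
        (solve 3 (λ x y r → r := x :+ ((con 0ℚ :- y) :+ (r :- (x :- y)))) refl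
          (seq x n) (seq x N) (½ ℚ.* ρ))))

-- The hull and its limit points

-- Inductive description of the hull: unlike `D`, it lives in `Set`, and its derivations admit
-- recursion. The inclusion in `D` is `hull⊆D`.
data Hull (u : ℝ) : ℝ → Set where
  hull-0    : Hull u 0ℝ
  hull-1    : Hull u 1ℝ
  hull-step : ∀ {x y} → Hull u x → Hull u y → Hull u (u * x + (1ℝ - u) * y)
  hull-resp : ∀ {x y} → x ≃ y → Hull u x → Hull u y

module _ {u : ℝ} where

  -- Recursion on the derivation of the weight: mixing with weight `u s + (1 - u) t` is the
  -- `u`-mixture of the mixtures with weights `s` and `t`. Every hull point may thus itself serve as
  -- a weight.
  hull-mix : ∀ {t x y} → Hull u t → Hull u x → Hull u y → Hull u (t * x + (1ℝ - t) * y)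
  hull-mix {x = x} {y} hull-0 hx hy = hull-resp (≃-pointwise λ n →
    solve 2 (λ x y → y := con 0ℚ :* x :+ (con 1ℚ :- con 0ℚ) :* y) refl (seq x n) (seq y n)) hy
  hull-mix {x = x} {y} hull-1 hx hy = hull-resp (≃-pointwise λ n →
    solve 2 (λ x y → x := con 1ℚ :* x :+ (con 1ℚ :- con 1ℚ) :* y) refl (seq x n) (seq y n)) hx
  hull-mix {x = x} {y} (hull-step {s} {t} hs ht) hx hy = hull-resp (≃-pointwise λ n →
      solve 5 (λ u s t x y →
        u :* (s :* x :+ (con 1ℚ :- s) :* y) :+ (con 1ℚ :- u) :* (t :* x :+ (con 1ℚ :- t) :* y)
        := (u :* s :+ (con 1ℚ :- u) :* t) :* x :+ (con 1ℚ :- (u :* s :+ (con 1ℚ :- u) :* t)) :* y)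
        refl (seq u n) (seq s n) (seq t n) (seq x n) (seq y n))
    (hull-step (hull-mix hs hx hy) (hull-mix ht hx hy))
  hull-mix {x = x} {y} (hull-resp e ht) hx hy = hull-resp
    (+-cong (*-congʳ x e) (*-congʳ y (minus-cong ≃-refl e))) (hull-mix ht hx hy)

  hull-u* : ∀ {x} → Hull u x → Hull u (u * x)
  hull-u* {x} hx = hull-resp (≃-pointwise λ n →
    solve 2 (λ u x → u :* x :+ (con 1ℚ :- u) :* con 0ℚ := u :* x) refl (seq u n) (seq x n))
    (hull-step hx hull-0)

  hull-[1-u]* : ∀ {x} → Hull u x → Hull u ((1ℝ - u) * x)
  hull-[1-u]* {x} hx = hull-resp (≃-pointwise λ n →
    solve 2 (λ u x → u :* con 0ℚ :+ (con 1ℚ :- u) :* x := (con 1ℚ :- u) :* x) refl (seq u n) (seq x n))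
    (hull-step hull-0 hx)

  -- Scaling `x` by `1 - u` and `y` by `u` beforehand gives both the same weight, so addition is
  -- available at the price of a factor `u (1 - u)`.
  hull-u[1-u]*+ : ∀ {x y} → Hull u x → Hull u y → Hull u (u * (1ℝ - u) * (x + y))
  hull-u[1-u]*+ {x} {y} hx hy = hull-resp (≃-pointwise λ n →
    solve 3 (λ u x y → u :* ((con 1ℚ :- u) :* x) :+ (con 1ℚ :- u) :* (u :* y)
                       := u :* (con 1ℚ :- u) :* (x :+ y)) refl (seq u n) (seq x n) (seq y n))
    (hull-step (hull-[1-u]* hx) (hull-u* hy))

-- Differences of hull points

record Difference (u δ : ℝ) : Set where
  constructor difference
  field
    {upper lower} : ℝ
    upper∈ : Hull u upper
    lower∈ : Hull u lower
    equals : δ ≃ upper - lower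

module _ {u : ℝ} where

  difference-resp : ∀ {δ δ′} → δ ≃ δ′ → Difference u δ → Difference u δ′
  difference-resp e (difference hx hy f) = difference hx hy (≃-trans (≃-sym e) f)

  difference-0 : Difference u 0ℝ
  difference-0 = difference hull-0 hull-0 (≃-pointwise λ _ → refl)

  difference-neg : ∀ {δ} → Difference u δ → Difference u (- δ)
  difference-neg (difference {x} {y} hx hy e) = difference hy hx
    (≃-trans (neg-cong e) (≃-pointwise λ n →
      solve 2 (λ x y → :- (x :- y) := y :- x) refl (seq x n) (seq y n)))

  difference-step : ∀ {δ η} → Difference u δ → Difference u η →
                    Difference u (u * δ + (1ℝ - u) * η)
  difference-step (difference {x} {y} hx hy e) (difference {z} {w} hz hw f) =
    difference (hull-step hx hz) (hull-step hy hw)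
      (≃-trans (+-cong (*-congˡ u e) (*-congˡ (1ℝ - u) f)) (≃-pointwise λ n →
        solve 5 (λ u x y z w → u :* (x :- y) :+ (con 1ℚ :- u) :* (z :- w)
                   := (u :* x :+ (con 1ℚ :- u) :* z) :- (u :* y :+ (con 1ℚ :- u) :* w))
          refl (seq u n) (seq x n) (seq y n) (seq z n) (seq w n)))

  difference-u[1-u]*+ : ∀ {δ η} → Difference u δ → Difference u η →
                        Difference u (u * (1ℝ - u) * (δ + η))
  difference-u[1-u]*+ (difference {x} {y} hx hy e) (difference {z} {w} hz hw f) =
    difference (hull-u[1-u]*+ hx hz) (hull-u[1-u]*+ hy hw)
      (≃-trans (*-congˡ (u * (1ℝ - u)) (+-cong e f)) (≃-pointwise λ n →
        solve 5 (λ u x y z w → u :* (con 1ℚ :- u) :* ((x :- y) :+ (z :- w))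
                   := u :* (con 1ℚ :- u) :* (x :+ z) :- u :* (con 1ℚ :- u) :* (y :+ w))
          refl (seq u n) (seq x n) (seq y n) (seq z n) (seq w n)))

-- Rational inversion is total once the argument is clipped below at `ρ`; from some index on the
-- clipping does nothing.
reciprocal : ∀ x {ρ} → 0ℚ ℚ.< ρ → AtLeast ρ x → ∃[ y ] x * y ≃ 1ℝ
reciprocal x {ρ} 0<ρ (atLeast (N , h)) =
  mkℝ (λ n → inv (seq x n)) inv-cauchy
  , ≃-eventually (N , λ n N≤n →
      trans (cong (ℚ._* inv (seq x n)) (sym (ℚ.p≤q⇒p⊔q≡q (h n N≤n)))) (clip-inv (seq x n)))
  where
  clip : ℚ → ℚ
  clip q = ρ ℚ.⊔ q

  0<clip : ∀ q → 0ℚ ℚ.< clip q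
  0<clip q = ℚ.<-≤-trans 0<ρ (ℚ.p≤p⊔q ρ q)

  inv : ℚ → ℚ
  inv q = proj₁ (quotient (0<clip q) 0<1)

  0≤inv : ∀ q → 0ℚ ℚ.≤ inv q
  0≤inv q = ℚ.<⇒≤ (proj₁ (proj₂ (quotient (0<clip q) 0<1)))

  clip-inv : ∀ q → clip q ℚ.* inv q ≡ 1ℚ
  clip-inv q = proj₂ (proj₂ (quotient (0<clip q) 0<1))

  R = proj₁ (quotient 0<ρ 0<1)
  0<R = proj₁ (proj₂ (quotient 0<ρ 0<1))
  ρR≡1 = proj₂ (proj₂ (quotient 0<ρ 0<1))

  inv≤R : ∀ q → ∣ inv q ∣ ℚ.≤ R
  inv≤R q = subst (ℚ._≤ R) (sym (ℚ.0≤p⇒∣p∣≡p (0≤inv q)))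
    (≤-by (R ℚ.* inv q ℚ.* (clip q ℚ.- ρ))
      (0≤* (0≤* (ℚ.<⇒≤ 0<R) (0≤inv q)) (p≤q⇒0≤q-p (ℚ.p≤p⊔q ρ q)))
      (begin
        R                                                        ≡⟨ ℚ.*-identityʳ R ⟨
        R ℚ.* 1ℚ                                                 ≡⟨ cong (R ℚ.*_) (clip-inv q) ⟨
        R ℚ.* (clip q ℚ.* inv q)
          ≡⟨ solve 4 (λ R c i r → R :* (c :* i) := i :* (r :* R) :+ R :* i :* (c :- r)) refl
               R (clip q) (inv q) ρ ⟩
        inv q ℚ.* (ρ ℚ.* R) ℚ.+ R ℚ.* inv q ℚ.* (clip q ℚ.- ρ)
          ≡⟨ cong (λ t → t ℚ.+ R ℚ.* inv q ℚ.* (clip q ℚ.- ρ))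
               (trans (cong (inv q ℚ.*_) ρR≡1) (ℚ.*-identityʳ (inv q))) ⟩
        inv q ℚ.+ R ℚ.* inv q ℚ.* (clip q ℚ.- ρ)                 ∎))
    where open ≡-Reasoning

  -- Inversion of clipped arguments is Lipschitz with constant `R * R`, where `R = 1 / ρ`.
  inv-diff : ∀ p q → inv p ℚ.* inv q ℚ.* (clip q ℚ.- clip p) ≡ inv p ℚ.- inv q
  inv-diff p q = trans
    (solve 4 (λ i j c d → i :* j :* (d :- c) := i :* (d :* j) :- j :* (c :* i)) refl
      (inv p) (inv q) (clip p) (clip q))
    (cong₂ ℚ._-_ (trans (cong (inv p ℚ.*_) (clip-inv q)) (ℚ.*-identityʳ (inv p)))
                 (trans (cong (inv q ℚ.*_) (clip-inv p)) (ℚ.*-identityʳ (inv q))))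

  inv-cauchy : IsCauchy (λ n → inv (seq x n))
  inv-cauchy ε 0<ε =
    let (δ , 0<δ , RRδ≡ε) = quotient (0<* 0<R 0<R) 0<ε
        (M , g) = cauchy x δ 0<δ
    in N ℕ.⊔ M , λ m n ≤m ≤n → subst₂ ℚ._<_ (cong ∣_∣ (inv-diff (seq x m) (seq x n))) RRδ≡ε
      (ℚ.≤-<-trans
        (∣*∣≤ (inv (seq x m) ℚ.* inv (seq x n)) (clip (seq x n) ℚ.- clip (seq x m))
          (∣*∣≤ (inv (seq x m)) (inv (seq x n)) (inv≤R (seq x m)) (inv≤R (seq x n)))
          (ℚ.≤-reflexive (cong₂ (λ s t → ∣ s ℚ.- t ∣)
            (ℚ.p≤q⇒p⊔q≡q (h n (ℕ.m⊔n≤o⇒m≤o N M ≤n)))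
            (ℚ.p≤q⇒p⊔q≡q (h m (ℕ.m⊔n≤o⇒m≤o N M ≤m))))))
        (ℚ.*-monoʳ-<-pos (R ℚ.* R) {{ℚ.positive (0<* 0<R 0<R)}}
          (g n m (ℕ.m⊔n≤o⇒n≤o N M ≤n) (ℕ.m⊔n≤o⇒n≤o N M ≤m))))

½^ : ℕ → ℚ
½^ zero    = 1ℚ
½^ (suc n) = ½ ℚ.* ½^ n

0<½^ : ∀ n → 0ℚ ℚ.< ½^ n
0<½^ zero    = 0<1
0<½^ (suc n) = 0<* 0<½ (0<½^ n)

½^≤1 : ∀ n → ½^ n ℚ.≤ 1ℚ
½^≤1 zero    = ℚ.≤-refl
½^≤1 (suc n) = ≤-by _ (0≤+ (p≤q⇒0≤q-p (½^≤1 n)) (0≤* (ℚ.<⇒≤ 0<½) (ℚ.<⇒≤ (0<½^ n))))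
  (solve 1 (λ p → con 1ℚ := con ½ :* p :+ ((con 1ℚ :- p) :+ con ½ :* p)) refl (½^ n))

½^*ι≤1 : ∀ n → ½^ n ℚ.* ι n ℚ.≤ 1ℚ
½^*ι≤1 zero    = ℚ.<⇒≤ 0<1
½^*ι≤1 (suc n) = ≤-by _
  (0≤+ (0≤* (ℚ.<⇒≤ 0<½) (p≤q⇒0≤q-p (½^≤1 n))) (0≤* (ℚ.<⇒≤ 0<½) (p≤q⇒0≤q-p (½^*ι≤1 n))))
  (solve 2 (λ p i → con 1ℚ := con ½ :* p :* (con 1ℚ :+ i)
                      :+ (con ½ :* (con 1ℚ :- p) :+ con ½ :* (con 1ℚ :- p :* i)))
     refl (½^ n) (ι n))

-- With `q = M / η` and `n ≥ q`, `½^ n * M = η * (½^ n * q) ≤ η * (½^ n * n) ≤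
-- η`, the last step being `½^*ι≤1`.
½^-null : ∀ {M η} → 0ℚ ℚ.< M → 0ℚ ℚ.< η → ∃[ n ] ½^ n ℚ.* M ℚ.≤ η
½^-null {M} {η} 0<M 0<η =
  let (q , _ , ηq≡M) = quotient 0<η 0<M
      (n , q≤n)      = archimedes q
  in n , ≤-by (η ℚ.* (1ℚ ℚ.- ½^ n ℚ.* ι n) ℚ.+ ½^ n ℚ.* η ℚ.* (ι n ℚ.- q))
    (0≤+ (0≤* (ℚ.<⇒≤ 0<η) (p≤q⇒0≤q-p (½^*ι≤1 n)))
         (0≤* (0≤* (ℚ.<⇒≤ (0<½^ n)) (ℚ.<⇒≤ 0<η)) (p≤q⇒0≤q-p q≤n)))
    (trans (solve 4 (λ p e i q → e := p :* (e :* q)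
               :+ (e :* (con 1ℚ :- p :* i) :+ p :* e :* (i :- q))) refl (½^ n) η (ι n) q)
       (cong (λ t → ½^ n ℚ.* t ℚ.+ (η ℚ.* (1ℚ ℚ.- ½^ n ℚ.* ι n) ℚ.+ ½^ n ℚ.* η ℚ.* (ι n ℚ.- q)))
         ηq≡M))

infixr 8 _^_
_^_ : ℝ → ℕ → ℝ
x ^ zero  = 1ℝ
x ^ suc n = x * x ^ n

^-≄0 : ∀ {x} → ¬ (x ≃ 0ℝ) → ∀ n → ¬ (x ^ n ≃ 0ℝ)
^-≄0 x≄0 zero    e = apart⇒≄0 {1ℝ} (atLeast⇒apart 0<1 (atLeast (ev-always λ _ → ℚ.≤-refl))) e
^-≄0 x≄0 (suc n) e = ^-≄0 x≄0 n (≄0-cancel x≄0 e)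

^-bound : ∀ {x} → Bound x ½ → ∀ n → Bound (x ^ n) (½^ n)
^-bound x≤½ zero    = bound (ev-always λ _ → ℚ.≤-refl)
^-bound x≤½ (suc n) = bound-* x≤½ (^-bound x≤½ n)

-- Limit points from a small difference

module _ {u x y : ℝ} (x∈ : Hull u x) (y∈ : Hull u y)
         (δ≄0 : ¬ (x - y ≃ 0ℝ)) (δ≤½ : Bound (x - y) ½) where
  private
    δ : ℝ
    δ = x - y

    orbit : ℝ → ℕ → ℝ
    orbit c zero    = c
    orbit c (suc n) = orbit c n * x + (1ℝ - orbit c n) * y

    orbit∈ : ∀ {c} → Hull u c → ∀ n → Hull u (orbit c n)
    orbit∈ c∈ zero    = c∈
    orbit∈ c∈ (suc n) = hull-mix (orbit∈ c∈ n) x∈ y∈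

    ½≤1-δ : AtLeast ½ (1ℝ - δ)
    ½≤1-δ = atLeast (ev-map (λ n p → ≤-by _ (p≤q⇒0≤q-p (ℚ.≤-trans (p≤∣p∣ (seq δ n)) p))
      (solve 1 (λ d → con 1ℚ :- d := con ½ :+ (con ½ :- d)) refl (seq δ n))) (below δ≤½))

    inverse : ∃[ w ] (1ℝ - δ) * w ≃ 1ℝ
    inverse = reciprocal (1ℝ - δ) 0<½ ½≤1-δ

    w L : ℝ
    w = proj₁ inverse
    L = y * w

    L-fixed : L ≃ y + δ * L
    L-fixed = ≃-trans (≃-pointwise λ n →
        solve 3 (λ y d w → y :* w := y :* ((con 1ℚ :- d) :* w) :+ d :* (y :* w)) refl
          (seq y n) (seq δ n) (seq w n))
      (+-cong (≃-trans (*-congˡ y (proj₂ inverse)) (≃-pointwise λ n → ℚ.*-identityʳ (seq y n))) ≃-refl)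

    -- The map `t ↦ t x + (1 - t) y` is `t ↦ y + δ t`, so each step multiplies the offset from its
    -- fixed point `L` by `δ`.
    orbit-error : ∀ c n → orbit c n - L ≃ δ ^ n * (c - L)
    orbit-error c zero    = ≃-pointwise λ n → sym (ℚ.*-identityˡ (seq (c - L) n))
    orbit-error c (suc n) = ≃-trans (minus-cong ≃-refl L-fixed)
      (≃-trans (≃-pointwise λ k →
        solve 4 (λ p x y l → (p :* x :+ (con 1ℚ :- p) :* y) :- (y :+ (x :- y) :* l)
                              := (x :- y) :* (p :- l)) refl
          (seq (orbit c n) k) (seq x k) (seq y k) (seq L k))
      (≃-trans (*-congˡ δ (orbit-error c n)) (≃-pointwise λ k →
        sym (ℚ.*-assoc (seq δ k) (seq (δ ^ n) k) (seq (c - L) k)))))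

    -- Powers of `δ` are nonzero and cannot annihilate `c - L`: an orbit that starts off `L` never
    -- reaches it.
    orbit≉L : ∀ {c} → ¬ (c ≃ L) → ∀ n → ¬ (orbit c n ≈ L)
    orbit≉L {c} c≄L n e = c≄L (x-y≃0⇒x≃y (≄0-cancel (^-≄0 δ≄0 n)
      (≃-trans (≃-sym (orbit-error c n)) (x≃y⇒x-y≃0 (equal e)))))

    limitPoint : ∀ {c} → Hull u c → ¬ (c ≃ L) → IsLimitPoint (Hull u) L
    limitPoint {c} c∈ c≄L ε (η , 0<η , N , h) =
      let (M , 0<M , c≤M) = bounded (c - L)
          -- The error is pushed down to a quarter of `η`; `bound-resp` takes a margin and leaves
          -- `½ * η`, and the other half witnesses the strict inequalities.
          (n , ≤¼η)       = ½^-null 0<M (0<* 0<½ (0<* 0<½ 0<η))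
          near : Bound (orbit c n - L) (½ ℚ.* η)
          near = bound-resp (≃-sym (orbit-error c n))
            (ℚ.≤-<-trans ≤¼η (<-by _ (0<* 0<½ (0<* 0<½ 0<η))
              (solve 1 (λ e → con ½ :* e := con ½ :* (con ½ :* e) :+ con ½ :* (con ½ :* e)) refl η)))
            (bound-* (^-bound δ≤½ n) c≤M)
          v = orbit c n
      in v , orbit∈ c∈ n , orbit≉L c≄L n
       , (½ ℚ.* η , 0<* 0<½ 0<η , ev-zip (λ k p q → ≤-by _
            (0≤+ (p≤q⇒0≤q-p q) (p≤q⇒0≤q-p (ℚ.≤-trans (-p≤∣p∣ (seq v k ℚ.- seq L k)) p)))
            (solve 4 (λ v l ε η → v := ((l :- ε) :+ con ½ :* η)
                 :+ ((ε :- (con 0ℚ :+ η)) :+ (con ½ :* η :- :- (v :- l)))) refl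
              (seq v k) (seq L k) (seq ε k) η))
            (below near) (N , h))
       , (½ ℚ.* η , 0<* 0<½ 0<η , ev-zip (λ k p q → ≤-by _
            (0≤+ (p≤q⇒0≤q-p q) (p≤q⇒0≤q-p (ℚ.≤-trans (p≤∣p∣ (seq v k ℚ.- seq L k)) p)))
            (solve 4 (λ v l ε η → l :+ ε := (v :+ con ½ :* η)
                 :+ ((ε :- (con 0ℚ :+ η)) :+ (con ½ :* η :- (v :- l)))) refl
              (seq v k) (seq L k) (seq ε k) η))
            (below near) (N , h))

  -- One of 0 and 1 differs from L; a double negation does not ask which.
  small-difference⇒limitPoint : ¬ ¬ ∃ (IsLimitPoint (Hull u))
  small-difference⇒limitPoint none =
    none (L , limitPoint hull-0 λ 0≃L →
    none (L , limitPoint hull-1 λ 1≃L →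
    -- At exponent 0 this says that 1 is not 0.
    ^-≄0 δ≄0 0 (≃-trans 1≃L (≃-sym 0≃L))))

-- Horner sums in the hull

-- Adding `ι S` moves the approximation `seq x N` into `[0, 2 S]`, where `round` applies. The error
-- 2 is 1 from rounding plus 1 for the variation of `x` after `N`.
round-real : ∀ x S → Bound x (ι S) →
  ∃[ m ] m ℕ.≤ S ℕ.+ S × Bound (x + fromℚ (ι S ℚ.- ι m)) 2ℚ
round-real x S (bound (N₁ , x≤S)) =
  let (N₂ , h) = cauchy x 1ℚ 0<1
      N        = N₁ ℕ.⊔ N₂
      xN≤S     = x≤S N (ℕ.m≤m⊔n N₁ N₂)
      (m , m≤ , near) = round (S ℕ.+ S) {seq x N ℚ.+ ι S}
        (≤-by _ (p≤q⇒0≤q-p (ℚ.≤-trans (-p≤∣p∣ (seq x N)) xN≤S))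
          (solve 2 (λ x s → x :+ s := con 0ℚ :+ (s :- :- x)) refl (seq x N) (ι S)))
        (≤-by _ (p≤q⇒0≤q-p (ℚ.≤-trans (p≤∣p∣ (seq x N)) xN≤S))
          (trans (ι-+ S S)
            (solve 2 (λ x s → s :+ s := (x :+ s) :+ (s :- x)) refl (seq x N) (ι S))))
  in m , m≤ , bound (N , λ n N≤n → subst (λ t → ∣ t ∣ ℚ.≤ 2ℚ)
       (solve 4 (λ x y s m → (x :- y) :+ ((y :+ s) :- m) := x :+ (s :- m)) refl
         (seq x n) (seq x N) (ι S) (ι m))
       (∣+∣≤ (seq x n ℚ.- seq x N) ((seq x N ℚ.+ ι S) ℚ.- ι m)
         (ℚ.<⇒≤ (h n N (ℕ.m⊔n≤o⇒n≤o N₁ N₂ N≤n) (ℕ.m≤n⊔m N₁ N₂))) near))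

-- The reals `K * s n` lie in `[-2 K, 2 K]` and are rounded to finitely many integers; two with the
-- same rounding are within 2 of a common integer, hence within 4 of one another.
close-pair : ∀ (s : ℕ → ℝ) K → (∀ n → Bound (s n) 2ℚ) →
  ∃₂ λ n m → n ℕ.< m × Bound (fromℚ (ι K) * (s m - s n)) (2ℚ ℚ.+ 2ℚ)
close-pair s K s≤2 =
  -- The roundings take at most `suc B` values, `0` to `B`, so `suc (suc B)` indices force a
  -- repetition.
  let (i , j , i<j , same) = pigeonhole (ℕ.n<1+n (suc B)) (λ i → fromℕ< (ℕ.s≤s (r≤B (toℕ i))))
      r-same : r (toℕ i) ≡ r (toℕ j)
      r-same = trans (sym (toℕ-fromℕ< (ℕ.s≤s (r≤B (toℕ i)))))
        (trans (cong toℕ same) (toℕ-fromℕ< (ℕ.s≤s (r≤B (toℕ j)))))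
  in toℕ i , toℕ j , i<j , cancel (toℕ i) (toℕ j) r-same
  where
  S B : ℕ
  S = K ℕ.+ K
  B = S ℕ.+ S

  scaled≤S : ∀ n → Bound (fromℚ (ι K) * s n) (ι S)
  scaled≤S n = bound-weaken (ℚ.≤-reflexive (trans
      (solve 1 (λ k → k :* con 2ℚ := k :+ k) refl (ι K)) (sym (ι-+ K K))))
    (bound-* (bound {fromℚ (ι K)} (ev-always λ _ → ℚ.≤-reflexive (ℚ.0≤p⇒∣p∣≡p (0≤ι K)))) (s≤2 n))

  rounded : ∀ n → _
  rounded n = round-real (fromℚ (ι K) * s n) S (scaled≤S n)

  r : ℕ → ℕ
  r n = proj₁ (rounded n)

  r≤B : ∀ n → r n ℕ.≤ B
  r≤B n = proj₁ (proj₂ (rounded n))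

  near : ∀ n → Bound (fromℚ (ι K) * s n + fromℚ (ι S ℚ.- ι (r n))) 2ℚ
  near n = proj₂ (proj₂ (rounded n))

  cancel : ∀ n m → r n ≡ r m → Bound (fromℚ (ι K) * (s m - s n)) (2ℚ ℚ.+ 2ℚ)
  cancel n m rn≡rm = bound (ev-zip (λ k p q → subst (ℚ._≤ 2ℚ ℚ.+ 2ℚ)
      (cong ∣_∣ (trans (cong (λ t → (ι K ℚ.* seq (s m) k ℚ.+ (ι S ℚ.- ι t))
                                    ℚ.- (ι K ℚ.* seq (s n) k ℚ.+ (ι S ℚ.- ι (r n)))) (sym rn≡rm))
        (solve 4 (λ K x y c → (K :* x :+ c) :- (K :* y :+ c) := K :* (x :- y)) refl
          (ι K) (seq (s m) k) (seq (s n) k) (ι S ℚ.- ι (r n)))))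
      (ℚ.≤-trans (ℚ.∣p-q∣≤∣p∣+∣q∣ (ι K ℚ.* seq (s m) k ℚ.+ (ι S ℚ.- ι (r m)))
                                    (ι K ℚ.* seq (s n) k ℚ.+ (ι S ℚ.- ι (r n)))) (ℚ.+-mono-≤ p q)))
    (below (near m)) (below (near n)))

-- This is the `j`-th power of `u (1 - u)`, the price of building the integers up to `j` by repeated
-- addition in the hull.
γ : ℝ → ℕ → ℝ
γ u zero    = 1ℝ
γ u (suc j) = u * (1ℝ - u) * γ u j

-- The factor `1 - u` is the weight with which a digit enters the Horner step `κ-horner`.
κ : ℝ → ℕ → ℝ
κ u j = (1ℝ - u) * γ u j

-- An integer split into two naturals, because `γ u j` times either part is a hull point and their
-- difference is then a `Difference`.
record Digit (j : ℕ) (d : ℚ) : Set where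
  constructor digit
  field
    {plus minus} : ℕ
    plus≤  : plus ℕ.≤ j
    minus≤ : minus ℕ.≤ j
    value  : d ≡ ι plus ℚ.- ι minus

module _ {u : ℝ} where

  γ∈ : ∀ j → Hull u (γ u j)
  γ∈ zero    = hull-1
  γ∈ (suc j) = hull-resp (≃-pointwise λ n →
    sym (ℚ.*-assoc (seq u n) (1ℚ ℚ.- seq u n) (seq (γ u j) n))) (hull-u* (hull-[1-u]* (γ∈ j)))

  -- One use of `hull-u[1-u]*+` adds `γ u j` to `γ u j * m` and turns the factor into `γ u (suc j)`.
  γι∈ : ∀ {m j} → m ℕ.≤ j → Hull u (γ u j * fromℚ (ι m))
  γι∈ {j = j} ℕ.z≤n = hull-resp (≃-pointwise λ n → sym (ℚ.*-zeroʳ (seq (γ u j) n))) hull-0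
  γι∈ {suc m} {suc j} (ℕ.s≤s m≤j) = hull-resp (≃-pointwise λ n →
      solve 3 (λ w g i → w :* (g :+ g :* i) := w :* g :* (con 1ℚ :+ i)) refl
        (seq u n ℚ.* (1ℚ ℚ.- seq u n)) (seq (γ u j) n) (ι m))
    (hull-u[1-u]*+ (γ∈ j) (γι∈ m≤j))

  -- The step mixes `κ s` and `γ d` with weights `u` and `1 - u`. Since `κ = (1 - u) γ`, the factor
  -- `κ` reappears unchanged, however many steps are made.
  κ-horner : ∀ {j s d} → Difference u (κ u j * s) → Digit j d →
             Difference u (κ u j * (u * s + fromℚ d))
  κ-horner {j} {s} {d} s∈ (digit {m} {l} m≤j l≤j d≡) = difference-resp (≃-pointwise λ n →
      trans (solve 5 (λ u g s m l → u :* ((con 1ℚ :- u) :* g :* s) :+ (con 1ℚ :- u) :* (g :* m :- g :* l)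
                  := (con 1ℚ :- u) :* g :* (u :* s :+ (m :- l))) refl
              (seq u n) (seq (γ u j) n) (seq s n) (ι m) (ι l))
        (cong (λ t → seq (κ u j) n ℚ.* (seq u n ℚ.* seq s n ℚ.+ t)) (sym d≡)))
    (difference-step s∈ (difference (γι∈ m≤j) (γι∈ l≤j) ≃-refl))

  κ-digit : ∀ {j d} → Digit j d → Difference u (κ u j * fromℚ d)
  κ-digit {j} {d} d-digit = difference-resp (≃-pointwise λ n →
      solve 3 (λ k u d → k :* (u :* con 0ℚ :+ d) := k :* d) refl (seq (κ u j) n) (seq u n) d)
    (κ-horner {s = 0ℝ} (difference-resp (≃-pointwise λ n → sym (ℚ.*-zeroʳ (seq (κ u j) n))) difference-0)
      d-digit)

-- C x x′ says that x′ is the image of x under a field embedding.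
record Conjugation (C : ℝ → ℝ → Set) : Set where
  field
    conj-const : ∀ q → C (fromℚ q) (fromℚ q)
    conj-+     : ∀ {x x′ y y′} → C x x′ → C y y′ → C (x + y) (x′ + y′)
    conj-*     : ∀ {x x′ y y′} → C x x′ → C y y′ → C (x * y) (x′ * y′)
    conj-neg   : ∀ {x x′} → C x x′ → C (- x) (- x′)
    conj-0     : ∀ {x x′} → C x x′ → x ≃ 0ℝ → x′ ≃ 0ℝ

-- A conjugate above 1 forces a limit point

module _ {C : ℝ → ℝ → Set} (conjugation : Conjugation C)
         {u v : ℝ} (conj-u : C u v) {ρ : ℚ} (1<ρ : 1ℚ ℚ.< ρ) (ρ≤v : AtLeast ρ v) where
  open Conjugation conjugation

  private
    0<ρ : 0ℚ ℚ.< ρ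
    0<ρ = ℚ.<-trans 0<1 1<ρ

    0<ρ-1 : 0ℚ ℚ.< ρ ℚ.- 1ℚ
    0<ρ-1 = p<q⇒0<q-p 1<ρ

    conj-1-u : C (1ℝ - u) (1ℝ - v)
    conj-1-u = conj-+ (conj-const 1ℚ) (conj-neg conj-u)

    conj-γ : ∀ j → C (γ u j) (γ v j)
    conj-γ zero    = conj-const 1ℚ
    conj-γ (suc j) = conj-* (conj-* conj-u conj-1-u) (conj-γ j)

    apart-v : Apart₀ v
    apart-v = atLeast⇒apart 0<ρ ρ≤v

    apart-1-v : Apart₀ (1ℝ - v)
    apart-1-v = apart 0<ρ-1 (ev-map (λ n p → ℚ.≤-trans
      (≤-by _ (p≤q⇒0≤q-p p) (solve 2 (λ r v → :- (con 1ℚ :- v) := (r :- con 1ℚ) :+ (v :- r)) refl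
        ρ (seq v n)))
      (-p≤∣p∣ (1ℚ ℚ.- seq v n))) (above ρ≤v))

    apart-γ : ∀ j → Apart₀ (γ v j)
    apart-γ zero    = atLeast⇒apart 0<1 (atLeast (ev-always λ _ → ℚ.≤-refl))
    apart-γ (suc j) = apart-* (apart-* apart-v apart-1-v) (apart-γ j)

  -- `here` and `there` are a term `sₙ` and its conjugate `tₙ`; `T` is the threshold beyond which
  -- multiplication by `v` outweighs the digits used.
  record State (j : ℕ) (T : ℚ) : Set where
    field
      here there : ℝ
      here∈      : Difference u (κ u j * here)
      conj       : C here there
      here≤2     : Bound here 2ℚ
      T≤there    : AtLeast T there

  open State

  private
    -- Rounding supplies the integer digit that brings `u s` back into `[-2, 2]`. Its two parts are
    -- `S` and some `m ≤ 2 S`, so `2 S ≤ j` makes it admissible.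
    advance : ∀ {j} S {s t} → S ℕ.+ S ℕ.≤ j → Difference u (κ u j * s) → C s t → Bound (u * s) (ι S) →
      ∃[ e ] Difference u (κ u j * (u * s + fromℚ e)) × C (u * s + fromℚ e) (v * t + fromℚ e)
             × Bound (u * s + fromℚ e) 2ℚ
    advance S {s} 2S≤j s∈ st us≤S =
      let (m , m≤2S , us+e≤2) = round-real (u * s) S us≤S
      in ι S ℚ.- ι m
       , κ-horner {s = s} s∈ (digit (ℕ.≤-trans (ℕ.m≤m+n S S) 2S≤j) (ℕ.≤-trans m≤2S 2S≤j) refl)
       , conj-+ (conj-* conj-u st) (conj-const (ι S ℚ.- ι m))
       , us+e≤2

    -- Here `w` stands for `u s`. From `w ≤ p` and `w + e ≥ -2` follows `e ≥ -p - 2`, while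
    -- `(v - 1) t ≥ (ρ - 1) T = p + 3`; at least 1 remains.
    growth : ∀ {p T} → 0ℚ ℚ.≤ T → (ρ ℚ.- 1ℚ) ℚ.* T ≡ p ℚ.+ 2ℚ ℚ.+ 1ℚ →
      ∀ {v t w e} → ρ ℚ.≤ v → T ℚ.≤ t → ∣ w ∣ ℚ.≤ p → ∣ w ℚ.+ e ∣ ℚ.≤ 2ℚ → 1ℚ ℚ.≤ (v ℚ.* t ℚ.+ e) ℚ.- t
    growth {p} {T} 0≤T T-eq {v} {t} {w} {e} ρ≤v T≤t w≤p w+e≤2 = begin
      1ℚ                                ≤⟨ ≤-by ((p ℚ.- w) ℚ.+ (2ℚ ℚ.- ℚ.- (w ℚ.+ e)))
                                            (0≤+ (p≤q⇒0≤q-p (ℚ.≤-trans (p≤∣p∣ w) w≤p))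
                                                 (p≤q⇒0≤q-p (ℚ.≤-trans (-p≤∣p∣ (w ℚ.+ e)) w+e≤2)))
                                            (solve 3 (λ p w e → p :+ con 2ℚ :+ con 1ℚ :+ e :=
                                               con 1ℚ :+ ((p :- w) :+ (con 2ℚ :- :- (w :+ e)))) refl p w e) ⟩
      (p ℚ.+ 2ℚ ℚ.+ 1ℚ) ℚ.+ e           ≡⟨ cong (ℚ._+ e) T-eq ⟨
      (ρ ℚ.- 1ℚ) ℚ.* T ℚ.+ e            ≤⟨ ≤-by ((v ℚ.- ρ) ℚ.* t ℚ.+ (ρ ℚ.- 1ℚ) ℚ.* (t ℚ.- T))
                                            (0≤+ (0≤* (p≤q⇒0≤q-p ρ≤v) (ℚ.≤-trans 0≤T T≤t))
                                                 (0≤* (ℚ.<⇒≤ 0<ρ-1) (p≤q⇒0≤q-p T≤t)))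
                                            (solve 5 (λ r v t T e → (v :* t :+ e) :- t :=
                                               ((r :- con 1ℚ) :* T :+ e)
                                               :+ ((v :- r) :* t :+ (r :- con 1ℚ) :* (t :- T))) refl ρ v t T e) ⟩
      (v ℚ.* t ℚ.+ e) ℚ.- t             ∎
      where open ℚ.≤-Reasoning

    atLeast-1+ : ∀ {T x y} → AtLeast T x → AtLeast 1ℚ (y - x) → AtLeast (T ℚ.+ 1ℚ) y
    atLeast-1+ {T} {x} {y} (atLeast p) (atLeast q) = atLeast (ev-zip (λ n T≤x 1≤y-x → ≤-by _
      (0≤+ (p≤q⇒0≤q-p T≤x) (p≤q⇒0≤q-p 1≤y-x))
      (solve 3 (λ T x y → y := (T :+ con 1ℚ) :+ ((x :- T) :+ ((y :- x) :- con 1ℚ))) refl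
        T (seq x n) (seq y n))) p q)

    next : ∀ {j} S {T U} → S ℕ.+ S ℕ.≤ j → Bound u U → U ℚ.* 2ℚ ℚ.≤ ι S → 0ℚ ℚ.≤ T →
      (ρ ℚ.- 1ℚ) ℚ.* T ≡ U ℚ.* 2ℚ ℚ.+ 2ℚ ℚ.+ 1ℚ →
      (σ : State j T) → ∃[ τ ] AtLeast 1ℚ (there {j} {T} τ - there σ)
    next {j} S {T} {U} 2S≤j u≤U 2U≤S 0≤T T-eq
         record { here = s ; there = t ; here∈ = s∈ ; conj = st ; here≤2 = s≤2 ; T≤there = T≤t } =
      finish (advance S 2S≤j s∈ st (bound-weaken 2U≤S us≤2U))
      where
      us≤2U : Bound (u * s) (U ℚ.* 2ℚ)
      us≤2U = bound-* u≤U s≤2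

      finish : ∃[ e ] Difference u (κ u j * (u * s + fromℚ e)) × C (u * s + fromℚ e) (v * t + fromℚ e)
                      × Bound (u * s + fromℚ e) 2ℚ →
               ∃[ τ ] AtLeast 1ℚ (there {j} {T} τ - t)
      finish (e , s′∈ , s′t′ , s′≤2) = record
          { here∈ = s′∈ ; conj = s′t′ ; here≤2 = s′≤2
          ; T≤there = atLeast (ev-map (λ n → ℚ.≤-trans (≤-by 1ℚ (ℚ.<⇒≤ 0<1) refl))
              (above (atLeast-1+ T≤t grows))) }
        , grows
        where
        grows : AtLeast 1ℚ ((v * t + fromℚ e) - t)
        grows = atLeast (ev-zip (λ n (ρ≤v , T≤t) (us≤ , s′≤) → growth 0≤T T-eq ρ≤v T≤t us≤ s′≤)
          (ev-zip (λ _ → _,_) (above ρ≤v) (above T≤t))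
          (ev-zip (λ _ → _,_) (below us≤2U) (below s′≤2)))

    -- The conjugate `v d + e` is `(v - u) d + (u d + e)`, whose second summand is at least -2; the
    -- hypothesis with `T + 2` allows for it.
    start : ∀ {j} S {T d} → S ℕ.+ S ℕ.≤ j → Digit j d → Bound (u * fromℚ d) (ι S) →
            AtLeast (T ℚ.+ 2ℚ) ((v - u) * fromℚ d) → State j T
    start S {T} {d} 2S≤j d-digit ud≤S far =
      let (e , s′∈ , s′t′ , s′≤2) = advance S {fromℚ d} 2S≤j (κ-digit d-digit) (conj-const d) ud≤S
      in record
        { here = u * fromℚ d + fromℚ e ; there = v * fromℚ d + fromℚ e
        ; here∈ = s′∈ ; conj = s′t′ ; here≤2 = s′≤2
        ; T≤there = atLeast (ev-zip (λ n p q → ≤-by _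
            (0≤+ (p≤q⇒0≤q-p p)
                 (p≤q⇒0≤q-p (ℚ.≤-trans (-p≤∣p∣ (seq u n ℚ.* d ℚ.+ e)) q)))
            (solve 5 (λ u v d e T → v :* d :+ e := T :+ (((v :- u) :* d :- (T :+ con 2ℚ))
                 :+ (con 2ℚ :- :- (u :* d :+ e)))) refl (seq u n) (seq v n) d e T))
          (above far) (below s′≤2)) }

    -- The digit is `k` or `-k` according to the sign of `v - u`, with `k ≥ T / η` where `η` bounds
    -- `∣ v - u ∣` from below.
    far-digit : Apart₀ (v - u) → ∀ {T} → 0ℚ ℚ.< T →
      ∃₂ λ k d → Digit k d × AtLeast T ((v - u) * fromℚ d)
    far-digit v#u {T} 0<T =
      let (η , 0<η , side) = apart-sign v#u
          (q , _ , ηq≡T)   = quotient 0<η 0<T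
          (k , q≤k)        = archimedes q
          T≤ : ∀ {x} → η ℚ.≤ x → T ℚ.≤ x ℚ.* ι k
          T≤ = λ {x} η≤x → subst (ℚ._≤ x ℚ.* ι k) ηq≡T
            (≤-by _ (0≤+ (0≤* (ℚ.<⇒≤ 0<η) (p≤q⇒0≤q-p q≤k)) (0≤* (p≤q⇒0≤q-p η≤x) (0≤ι k)))
              (solve 4 (λ x k e q → x :* k := e :* q :+ (e :* (k :- q) :+ (x :- e) :* k)) refl
                x (ι k) η q))
          go : AtLeast η (v - u) ⊎ AtLeast η (- (v - u)) → _
          go = λ
            { (inj₁ pos) → k , ι k ℚ.- ι 0 , digit ℕ.≤-refl ℕ.z≤n refl
                , atLeast (ev-map (λ n p → subst (T ℚ.≤_)
                    (solve 2 (λ x k → x :* k := x :* (k :- con 0ℚ)) refl (seq (v - u) n) (ι k)) (T≤ p))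
                    (above pos))
            ; (inj₂ neg) → k , ι 0 ℚ.- ι k , digit ℕ.z≤n ℕ.≤-refl refl
                , atLeast (ev-map (λ n p → subst (T ℚ.≤_)
                    (solve 2 (λ x k → :- x :* k := x :* (con 0ℚ :- k)) refl (seq (v - u) n) (ι k)) (T≤ p))
                    (above neg)) }
      in go side

    digit-mono : ∀ {i j d} → i ℕ.≤ j → Digit i d → Digit j d
    digit-mono i≤j (digit p q e) = digit (ℕ.≤-trans p i≤j) (ℕ.≤-trans q i≤j) e

    Run : Set
    Run = ∃₂ λ j T → Σ[ σ ∈ (ℕ → State j T) ]
            (∀ {n m} → n ℕ.< m → AtLeast 1ℚ (there (σ m) - there (σ n)))

    iterate : ∀ {j T} → State j T →
      ((σ : State j T) → ∃[ τ ] AtLeast 1ℚ (there {j} {T} τ - there σ)) → Run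
    iterate {j} {T} σ₀ f = j , T , σ , λ {n} {m} → increasing n m
      where
      σ : ℕ → State j T
      σ zero    = σ₀
      σ (suc n) = proj₁ (f (σ n))

      increasing : ∀ n m → n ℕ.< m → AtLeast 1ℚ (there (σ m) - there (σ n))
      increasing n (suc m) n<1+m with ℕ.m<1+n⇒m<n∨m≡n n<1+m
      ... | inj₂ refl = proj₂ (f (σ m))
      ... | inj₁ n<m  = atLeast (ev-zip (λ k p q → ≤-by _ (0≤+ (0≤+ (p≤q⇒0≤q-p p) (ℚ.<⇒≤ 0<1)) (p≤q⇒0≤q-p q))
        (solve 3 (λ a b c → c :- a := con 1ℚ :+ (((c :- b) :- con 1ℚ) :+ con 1ℚ :+ ((b :- a) :- con 1ℚ)))
          refl (seq (there (σ n)) k) (seq (there (σ m)) k) (seq (there (σ (suc m))) k)))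
        (above (proj₂ (f (σ m)))) (above (increasing n m n<m)))

    -- The constants are chosen in the order `U`, `T`, `d`, `S`: `U` bounds `u`, `T` solves the
    -- equation of `growth`, `d` lifts the start to `T`, and `S` bounds both `u s` and `u d`. Then
    -- `j = 2 S + k` admits the rounding digits as well as `d`.
    run : Apart₀ (v - u) → Run
    run v#u = choose-T (bounded u)
      where
      choose-S : ∀ {U T k d} → 0ℚ ℚ.< U → Bound u U → 0ℚ ℚ.< T →
        (ρ ℚ.- 1ℚ) ℚ.* T ≡ U ℚ.* 2ℚ ℚ.+ 2ℚ ℚ.+ 1ℚ →
        Digit k d → AtLeast (T ℚ.+ 2ℚ) ((v - u) * fromℚ d) →
        ∃[ S ] U ℚ.* 2ℚ ℚ.+ U ℚ.* ∣ d ∣ ℚ.≤ ι S → Run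
      choose-S {U} {T} {k} {d} 0<U u≤U 0<T T-eq d-digit far (S , ≤S) =
        iterate (start S 2S≤j (digit-mono (ℕ.m≤n+m k (S ℕ.+ S)) d-digit) ud≤S far)
                (next S 2S≤j u≤U 2U≤S (ℚ.<⇒≤ 0<T) T-eq)
        where
        2S≤j : S ℕ.+ S ℕ.≤ S ℕ.+ S ℕ.+ k
        2S≤j = ℕ.m≤m+n (S ℕ.+ S) k

        2U≤S : U ℚ.* 2ℚ ℚ.≤ ι S
        2U≤S = ℚ.≤-trans (≤-by (U ℚ.* ∣ d ∣) (0≤* (ℚ.<⇒≤ 0<U) (ℚ.0≤∣p∣ d)) refl) ≤S

        ud≤S : Bound (u * fromℚ d) (ι S)
        ud≤S = bound-weaken
          (ℚ.≤-trans (≤-by (U ℚ.* 2ℚ) (ℚ.<⇒≤ (0<* 0<U 0<2)) (ℚ.+-comm (U ℚ.* 2ℚ) (U ℚ.* ∣ d ∣))) ≤S)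
          (bound-* u≤U (bound {fromℚ d} (ev-always λ _ → ℚ.≤-refl)))

      choose-d : ∀ {U T} → 0ℚ ℚ.< U → Bound u U → 0ℚ ℚ.< T →
        (ρ ℚ.- 1ℚ) ℚ.* T ≡ U ℚ.* 2ℚ ℚ.+ 2ℚ ℚ.+ 1ℚ →
        (∃₂ λ k d → Digit k d × AtLeast (T ℚ.+ 2ℚ) ((v - u) * fromℚ d)) → Run
      choose-d {U} 0<U u≤U 0<T T-eq (k , d , d-digit , far) =
        choose-S 0<U u≤U 0<T T-eq d-digit far (archimedes (U ℚ.* 2ℚ ℚ.+ U ℚ.* ∣ d ∣))

      choose-T : ∃[ U ] 0ℚ ℚ.< U × Bound u U → Run
      choose-T (U , 0<U , u≤U) =
        let (T , 0<T , T-eq) = quotient 0<ρ-1 (0<+ (0<+ (0<* 0<U 0<2) (ℚ.<⇒≤ 0<2)) (ℚ.<⇒≤ 0<1))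
        in choose-d 0<U u≤U 0<T T-eq (far-digit v#u (0<+ 0<T (ℚ.<⇒≤ 0<2)))

    ¼ 16ℚ : ℚ
    ¼   = ½ ℚ.* ½
    16ℚ = (2ℚ ℚ.+ 2ℚ) ℚ.* (2ℚ ℚ.+ 2ℚ)

    -- `K ∣ w x ∣ = ∣ w ∣ ∣ K x ∣ ≤ 4 M`. In `16 M ≤ K` one factor 4 pays for the distance of the
    -- close pair, the other for the target `¼`.
    shrink : ∀ w x {M K} → 0ℚ ℚ.< K → M ℚ.* 16ℚ ℚ.≤ K →
      ∣ w ∣ ℚ.≤ M → ∣ K ℚ.* x ∣ ℚ.≤ 2ℚ ℚ.+ 2ℚ → ∣ w ℚ.* x ∣ ℚ.≤ ¼
    shrink w x {M} {K} 0<K 16M≤K w≤M Kx≤4 = ℚ.*-cancelˡ-≤-pos K {{ℚ.positive 0<K}} (begin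
      K ℚ.* ∣ w ℚ.* x ∣        ≡⟨ cong (ℚ._* ∣ w ℚ.* x ∣) (ℚ.0≤p⇒∣p∣≡p (ℚ.<⇒≤ 0<K)) ⟨
      ∣ K ∣ ℚ.* ∣ w ℚ.* x ∣    ≡⟨ ℚ.∣p*q∣≡∣p∣*∣q∣ K (w ℚ.* x) ⟨
      ∣ K ℚ.* (w ℚ.* x) ∣      ≡⟨ cong ∣_∣ (solve 3 (λ w k x → k :* (w :* x) := w :* (k :* x)) refl w K x) ⟩
      ∣ w ℚ.* (K ℚ.* x) ∣      ≤⟨ ∣*∣≤ w (K ℚ.* x) w≤M Kx≤4 ⟩
      M ℚ.* (2ℚ ℚ.+ 2ℚ)        ≤⟨ ≤-by ((K ℚ.- M ℚ.* 16ℚ) ℚ.* ¼)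
                                    (0≤* (p≤q⇒0≤q-p 16M≤K) (ℚ.<⇒≤ (ℚ.positive⁻¹ ¼)))
                                    (solve 2 (λ M K → K :* con ¼ := M :* con (2ℚ ℚ.+ 2ℚ)
                                       :+ (K :- M :* con 16ℚ) :* con ¼) refl M K) ⟩
      K ℚ.* ¼                  ∎)
      where open ℚ.≤-Reasoning

    run⇒limitPoint : Run → ¬ ¬ ∃ (IsLimitPoint (Hull u))
    run⇒limitPoint (j , T , σ , increasing) = choose-K (bounded W)
      where
      W : ℝ
      -- `κ` makes each `here` a difference of hull points, and `u (1 - u)` is the price of
      -- subtracting two of them.
      W = u * (1ℝ - u) * κ u j

      module _ {n m : ℕ} (n<m : n ℕ.< m) where
        s s′ : ℝ
        s  = here (σ m)
        s′ = here (σ n)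

        δ∈ : Difference u (W * (s - s′))
        δ∈ = difference-resp (≃-pointwise λ i →
          solve 4 (λ w k s s′ → w :* (k :* s :- k :* s′) := w :* k :* (s :- s′)) refl
            (seq (u * (1ℝ - u)) i) (seq (κ u j) i) (seq s i) (seq s′ i))
          (difference-u[1-u]*+ (here∈ (σ m)) (difference-neg (here∈ (σ n))))

        conj-δ : C (W * (s - s′)) (v * (1ℝ - v) * κ v j * (there (σ m) - there (σ n)))
        conj-δ = conj-* (conj-* (conj-* conj-u conj-1-u) (conj-* conj-1-u (conj-γ j)))
          (conj-+ (conj (σ m)) (conj-neg (conj (σ n))))

        -- Read off on the conjugate side: there all factors are apart from 0, since `v > 1` and the
        -- two `there` terms differ by at least 1.
        δ≄0 : ¬ (W * (s - s′) ≃ 0ℝ)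
        δ≄0 δ≃0 = apart⇒≄0
          (apart-* (apart-* (apart-* apart-v apart-1-v) (apart-* apart-1-v (apart-γ j)))
                   (atLeast⇒apart 0<1 (increasing n<m)))
          (conj-0 conj-δ δ≃0)

        conclude : Bound (W * (s - s′)) ¼ → ¬ ¬ ∃ (IsLimitPoint (Hull u))
        conclude δ≤¼ = from δ∈
          where
          from : Difference u (W * (s - s′)) → ¬ ¬ ∃ (IsLimitPoint (Hull u))
          from (difference x∈ y∈ e) = small-difference⇒limitPoint x∈ y∈
            -- The gap between `¼` and `½` is the margin that `bound-resp` takes.
            (λ x-y≃0 → δ≄0 (≃-trans e x-y≃0)) (bound-resp e (<-by ¼ (ℚ.positive⁻¹ ¼) refl) δ≤¼)

      choose-pair : ∀ {M} K → 0ℚ ℚ.< M → Bound W M → M ℚ.* 16ℚ ℚ.≤ ι K →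
        (∃₂ λ n m → n ℕ.< m × Bound (fromℚ (ι K) * (here (σ m) - here (σ n))) (2ℚ ℚ.+ 2ℚ)) →
        ¬ ¬ ∃ (IsLimitPoint (Hull u))
      choose-pair {M} K 0<M W≤M 16M≤K (n , m , n<m , near) =
        conclude n<m (bound (ev-zip
          (λ i → shrink (seq W i) (seq (here (σ m) - here (σ n)) i)
                   (ℚ.<-≤-trans (0<* 0<M (ℚ.positive⁻¹ 16ℚ)) 16M≤K) 16M≤K)
          (below W≤M) (below near)))

      choose-K : ∃[ M ] 0ℚ ℚ.< M × Bound W M → ¬ ¬ ∃ (IsLimitPoint (Hull u))
      choose-K (M , 0<M , W≤M) =
        let (K , 16M≤K) = archimedes (M ℚ.* 16ℚ)
        in choose-pair K 0<M W≤M 16M≤K (close-pair (λ n → here (σ n)) K (λ n → here≤2 (σ n)))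

  -- The conclusion is a negation, so `¬ (v ≃ u)` may be used as if it were apartness of `v - u`
  -- from 0.
  conjugate>1⇒limitPoint : ¬ (v ≃ u) → ¬ ¬ ∃ (IsLimitPoint (Hull u))
  conjugate>1⇒limitPoint v≄u none =
    v≄u (x-y≃0⇒x≃y (¬apart⇒≃0 λ v#u → run⇒limitPoint (run v#u) none))

-- Conjugates and the minimal polynomial

-- The vector is read without the implicit leading term of `Monic`, as a polynomial of degree below
-- `n`.
poly : ∀ {n} → Vec ℚ n → ℝ → ℝ
poly []      x = 0ℝ
poly (c ∷ r) x = fromℚ c + x * poly r x

monic : ∀ {n} → Monic ℚ n → ℝ → ℝ
monic = eval ℝ-rawRing fromℚ

monic-poly : ∀ {n} (p : Monic ℚ n) x → monic p x ≃ poly p x + x ^ n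
monic-poly p x = ≃-pointwise (pointwise p)
  where
  pointwise : ∀ {n} (p : Monic ℚ n) i → seq (monic p x) i ≡ seq (poly p x + x ^ n) i
  pointwise []      i = refl
  pointwise {suc n} (c ∷ p) i = trans (cong (λ t → c ℚ.+ seq x i ℚ.* t) (pointwise p i))
    (solve 4 (λ c x p y → c :+ x :* (p :+ y) := c :+ x :* p :+ x :* y) refl
      c (seq x i) (seq (poly p x) i) (seq (x ^ n) i))

poly-+ : ∀ {n} (r s : Vec ℚ n) x → poly (zipWith ℚ._+_ r s) x ≃ poly r x + poly s x
poly-+ r s x = ≃-pointwise (pointwise r s)
  where
  pointwise : ∀ {n} (r s : Vec ℚ n) i → seq (poly (zipWith ℚ._+_ r s) x) i ≡ seq (poly r x + poly s x) i
  pointwise []      []      i = refl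
  pointwise (c ∷ r) (d ∷ s) i = trans (cong (λ t → (c ℚ.+ d) ℚ.+ seq x i ℚ.* t) (pointwise r s i))
    (solve 5 (λ c d x r s → (c :+ d) :+ x :* (r :+ s) := (c :+ x :* r) :+ (d :+ x :* s)) refl
      c d (seq x i) (seq (poly r x) i) (seq (poly s x) i))

poly-scale : ∀ {n} q (r : Vec ℚ n) x → poly (map (q ℚ.*_) r) x ≃ fromℚ q * poly r x
poly-scale q r x = ≃-pointwise (pointwise r)
  where
  pointwise : ∀ {n} (r : Vec ℚ n) i → seq (poly (map (q ℚ.*_) r) x) i ≡ seq (fromℚ q * poly r x) i
  pointwise []      i = sym (ℚ.*-zeroʳ q)
  pointwise (c ∷ r) i = trans (cong (λ t → q ℚ.* c ℚ.+ seq x i ℚ.* t) (pointwise r i))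
    (solve 4 (λ q c x r → q :* c :+ x :* (q :* r) := q :* (c :+ x :* r)) refl
      q c (seq x i) (seq (poly r x) i))

poly-0 : ∀ n x → poly (replicate n 0ℚ) x ≃ 0ℝ
poly-0 n x = ≃-pointwise (pointwise n)
  where
  pointwise : ∀ n i → seq (poly (replicate n 0ℚ) x) i ≡ 0ℚ
  pointwise zero    i = refl
  pointwise (suc n) i = trans (cong (λ t → 0ℚ ℚ.+ seq x i ℚ.* t) (pointwise n i))
    (solve 1 (λ x → con 0ℚ :+ x :* con 0ℚ := con 0ℚ) refl (seq x i))

-- c + X r, split as a polynomial of degree < n plus a multiple of Xⁿ.
shift : ∀ {n} → ℚ → Vec ℚ n → Vec ℚ n × ℚ
shift c []      = [] , c
shift c (d ∷ r) = c ∷ proj₁ (shift d r) , proj₂ (shift d r)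

poly-shift : ∀ {n} c (r : Vec ℚ n) x →
  fromℚ c + x * poly r x ≃ poly (proj₁ (shift c r)) x + fromℚ (proj₂ (shift c r)) * x ^ n
poly-shift c r x = ≃-pointwise (pointwise c r)
  where
  pointwise : ∀ {n} c (r : Vec ℚ n) i → seq (fromℚ c + x * poly r x) i ≡
    seq (poly (proj₁ (shift c r)) x + fromℚ (proj₂ (shift c r)) * x ^ n) i
  pointwise c []      i = solve 2 (λ c x → c :+ x :* con 0ℚ := con 0ℚ :+ c :* con 1ℚ) refl c (seq x i)
  pointwise {suc n} c (d ∷ r) i = trans (cong (λ t → c ℚ.+ seq x i ℚ.* t) (pointwise d r i))
    (solve 5 (λ c x r t y → c :+ x :* (r :+ t :* y) := c :+ x :* r :+ t :* (x :* y)) refl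
      c (seq x i) (seq (poly (proj₁ (shift d r)) x) i) (proj₂ (shift d r)) (seq (x ^ n) i))

fromℚ-apart : ∀ {q} → ¬ q ≡ 0ℚ → Apart₀ (fromℚ q)
fromℚ-apart {q} q≢0 = apart
  (ℚ.≰⇒> λ ∣q∣≤0 → q≢0 (ℚ.∣p∣≡0⇒p≡0 q (ℚ.≤-antisym ∣q∣≤0 (ℚ.0≤∣p∣ q))))
  (ev-always λ _ → ℚ.≤-refl)

-- Normalisation and division of polynomials

IsZero : ∀ {n} → Vec ℚ n → Set
IsZero r = ∀ x → poly r x ≃ 0ℝ

IsMultipleOfMonic : ∀ {n} → Vec ℚ n → Set
IsMultipleOfMonic {n} r = ∃[ e ] e ℕ.< n × Σ[ q ∈ Monic ℚ e ] ∃[ c ]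
  (¬ c ≡ 0ℚ) × (∀ x → poly r x ≃ fromℚ c * monic q x)

-- Minimality speaks of monic polynomials, so a nonzero polynomial has to be divided by its leading
-- coefficient `c`, which the recursion on the tail finds.
normalise : ∀ {n} (r : Vec ℚ n) → IsZero r ⊎ IsMultipleOfMonic r
normalise []      = inj₁ λ x → ≃-refl
normalise (d ∷ r) = extend (normalise r)
  where
  extend : IsZero r ⊎ IsMultipleOfMonic r → IsZero (d ∷ r) ⊎ IsMultipleOfMonic (d ∷ r)
  extend (inj₁ r≃0) with d ℚ.≟ 0ℚ
  ... | yes refl = inj₁ λ x → ≃-trans (+-cong (≃-refl {fromℚ d}) (*-congˡ x (r≃0 x))) (≃-pointwise λ i →
        solve 1 (λ x → con 0ℚ :+ x :* con 0ℚ := con 0ℚ) refl (seq x i))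
  ... | no d≢0   = inj₂ (0 , ℕ.s≤s ℕ.z≤n , [] , d , d≢0 , λ x →
        ≃-trans (+-cong (≃-refl {fromℚ d}) (*-congˡ x (r≃0 x))) (≃-pointwise λ i →
        solve 2 (λ d x → d :+ x :* con 0ℚ := d :* con 1ℚ) refl d (seq x i)))
  extend (inj₂ (e , e<n , q , c , c≢0 , r≃cq)) = inj₂ (suc e , ℕ.s≤s e<n , (c⁻¹ ℚ.* d) ∷ q , c , c≢0 , λ x →
      ≃-trans (+-cong (≃-refl {fromℚ d}) (*-congˡ x (r≃cq x))) (≃-pointwise λ i →
        trans (cong (ℚ._+ seq x i ℚ.* (c ℚ.* seq (monic q x) i))
                (trans (sym (ℚ.*-identityˡ d)) (cong (ℚ._* d) (sym (ℚ.*-inverseʳ c {{c≠0}})))))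
          (solve 5 (λ c c⁻¹ d x q → c :* c⁻¹ :* d :+ x :* (c :* q) := c :* (c⁻¹ :* d :+ x :* q)) refl
            c c⁻¹ d (seq x i) (seq (monic q x) i))))
    where
    c≠0 : ℚ.NonZero c
    c≠0 = ℚ.≢-nonZero c≢0
    c⁻¹ : ℚ
    c⁻¹ = (ℚ.1/ c) {{c≠0}}

-- Horner's scheme: the remainder `c` of the tail becomes the constant coefficient of the quotient,
-- and the new remainder is `d + q c`.
synthetic-division : ∀ {n} (p : Monic ℚ (suc n)) q →
  Σ[ p′ ∈ Monic ℚ n ] ∃[ c ] (∀ x → monic p x ≃ (x - fromℚ q) * monic p′ x + fromℚ c)
synthetic-division (d ∷ []) q = [] , d ℚ.+ q , λ x → ≃-pointwise λ i →
  solve 3 (λ d q x → d :+ x :* con 1ℚ := (x :- q) :* con 1ℚ :+ (d :+ q)) refl d q (seq x i)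
synthetic-division {suc n} (d ∷ p@(_ ∷ _)) q = extend (synthetic-division p q)
  where
  extend : Σ[ p′ ∈ Monic ℚ n ] ∃[ c ] (∀ x → monic p x ≃ (x - fromℚ q) * monic p′ x + fromℚ c) →
    Σ[ p′ ∈ Monic ℚ (suc n) ] ∃[ c ] (∀ x → monic (d ∷ p) x ≃ (x - fromℚ q) * monic p′ x + fromℚ c)
  extend (p′ , c , e) = c ∷ p′ , d ℚ.+ q ℚ.* c , λ x →
    ≃-trans (+-cong (≃-refl {fromℚ d}) (*-congˡ x (e x))) (≃-pointwise λ i →
      solve 5 (λ d q c x p → d :+ x :* ((x :- q) :* p :+ c)
                             := (x :- q) :* (c :+ x :* p) :+ (d :+ q :* c)) refl
        d q c (seq x i) (seq (monic p′ x) i))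

-- As `x y = -c`, a bound `M` on `y` keeps `∣ x ∣` above `ρ / (2 M)`, where `ρ ≤ ∣ c ∣`; the 2
-- covers the error with which the sequences satisfy the equation.
apart-factor : ∀ {x y c} → ¬ c ≡ 0ℚ → x * y + fromℚ c ≃ 0ℝ → Apart₀ x
apart-factor {x} {y} {c} c≢0 (equal xy+c≃0) = divide (bounded y) (fromℚ-apart c≢0)
  where
  divide : ∃[ M ] 0ℚ ℚ.< M × Bound y M → Apart₀ (fromℚ c) → Apart₀ x
  divide (M , 0<M , bound y≤M) (apart {ρ} 0<ρ ρ≤c) =
    let (η , 0<η , Mη≡½ρ) = quotient 0<M (0<* 0<½ 0<ρ)
    in apart 0<η (ev-zip (λ i y≤M (ρ≤c , near) → ℚ.*-cancelˡ-≤-pos M {{ℚ.positive 0<M}}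
         (subst (ℚ._≤ M ℚ.* ∣ seq x i ∣) (sym Mη≡½ρ) (ℚ.≤-trans (half i ρ≤c near)
           (subst (∣ seq x i ℚ.* seq y i ∣ ℚ.≤_) (ℚ.*-comm ∣ seq x i ∣ M)
             (∣*∣≤ (seq x i) (seq y i) ℚ.≤-refl y≤M)))))
       y≤M (ev-zip (λ _ → _,_) ρ≤c (xy+c≃0 (½ ℚ.* ρ) (0<* 0<½ 0<ρ))))
    where
    half : ∀ i → ρ ℚ.≤ ∣ c ∣ → ∣ (seq x i ℚ.* seq y i ℚ.+ c) ℚ.- 0ℚ ∣ ℚ.< ½ ℚ.* ρ →
           ½ ℚ.* ρ ℚ.≤ ∣ seq x i ℚ.* seq y i ∣
    half i ρ≤c near = ≤-by _ (p≤q⇒0≤q-p (ℚ.≤-trans ρ≤c (subst (λ t → ∣ t ∣ ℚ.≤ ½ ℚ.* ρ ℚ.+ ∣ seq x i ℚ.* seq y i ∣)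
        (solve 2 (λ p c → (p :+ c :- con 0ℚ) :- p := c) refl (seq x i ℚ.* seq y i) c)
        (∣-∣≤ ((seq x i ℚ.* seq y i ℚ.+ c) ℚ.- 0ℚ) (seq x i ℚ.* seq y i) (ℚ.<⇒≤ near) ℚ.≤-refl))))
      (solve 2 (λ r p → p := con ½ :* r :+ ((con ½ :* r :+ p) :- r)) refl ρ ∣ seq x i ℚ.* seq y i ∣)

-- The field embedding that sends `a` to `b`

module _ {k : ℕ} {μ : Monic ℚ (suc k)} {a b : ℝ} (μ-min : IsMinimalPolynomial μ a)
         (μb≃0 : monic μ b ≃ 0ℝ) where
  open IsMinimalPolynomial μ-min

  μa≃0 : monic μ a ≃ 0ℝ
  μa≃0 = equal root

  -- Elements of ℚ(a) and their images under a ↦ b, written in the power basis.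
  Conjugate : ℝ → ℝ → Set
  Conjugate x x′ = Σ[ r ∈ Vec ℚ (suc k) ] x ≃ poly r a × x′ ≃ poly r b

  private
    conjugate-const : ∀ q → Conjugate (fromℚ q) (fromℚ q)
    conjugate-const q = q ∷ replicate k 0ℚ , const a , const b
      where
      const : ∀ x → fromℚ q ≃ poly (q ∷ replicate k 0ℚ) x
      const x = ≃-sym (≃-trans (+-cong ≃-refl (*-congˡ x (poly-0 k x))) (≃-pointwise λ i →
        solve 2 (λ q x → q :+ x :* con 0ℚ := q) refl q (seq x i)))

    conjugate-+ : ∀ {x x′ y y′} → Conjugate x x′ → Conjugate y y′ → Conjugate (x + y) (x′ + y′)
    conjugate-+ (r , e , e′) (s , f , f′) = zipWith ℚ._+_ r s
      , ≃-trans (+-cong e f) (≃-sym (poly-+ r s a))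
      , ≃-trans (+-cong e′ f′) (≃-sym (poly-+ r s b))

    conjugate-scale : ∀ {x x′} q → Conjugate x x′ → Conjugate (fromℚ q * x) (fromℚ q * x′)
    conjugate-scale q (r , e , e′) = map (q ℚ.*_) r
      , ≃-trans (*-congˡ (fromℚ q) e) (≃-sym (poly-scale q r a))
      , ≃-trans (*-congˡ (fromℚ q) e′) (≃-sym (poly-scale q r b))

    conjugate-resp : ∀ {x x′ y y′} → x ≃ y → x′ ≃ y′ → Conjugate x x′ → Conjugate y y′
    conjugate-resp e e′ (r , f , f′) = r , ≃-trans (≃-sym e) f , ≃-trans (≃-sym e′) f′

    -- Xᵈ is replaced by Xᵈ - μ.
    reduce : Vec ℚ (suc k) → Vec ℚ (suc k)
    reduce r = zipWith ℚ._+_ (proj₁ (shift 0ℚ r)) (map (ℚ.- proj₂ (shift 0ℚ r) ℚ.*_) μ)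

    poly-reduce : ∀ {x} → monic μ x ≃ 0ℝ → ∀ r → x * poly r x ≃ poly (reduce r) x
    poly-reduce {x} μx≃0 r = ≃-trans (≃-pointwise λ i → sym (ℚ.+-identityˡ (seq (x * poly r x) i)))
      (≃-trans (poly-shift 0ℚ r x)
      (≃-trans (≃-pointwise λ i → solve 4 (λ p t y m → p :+ t :* y := p :+ :- t :* m :+ t :* (m :+ y)) refl
                 (seq (poly low x) i) top (seq (x ^ suc k) i) (seq (poly μ x) i))
      (≃-trans (+-cong (≃-sym (≃-trans (poly-+ low (map (ℚ.- top ℚ.*_) μ) x)
                                      (+-cong ≃-refl (poly-scale (ℚ.- top) μ x))))
                       (*-congˡ (fromℚ top) (≃-trans (≃-sym (monic-poly μ x)) μx≃0)))
               (≃-pointwise λ i → solve 2 (λ p t → p :+ t :* con 0ℚ := p) refl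
                 (seq (poly (reduce r) x) i) top))))
      where
      low = proj₁ (shift 0ℚ r)
      top = proj₂ (shift 0ℚ r)

    conjugate-gen* : ∀ {x x′} → Conjugate x x′ → Conjugate (a * x) (b * x′)
    conjugate-gen* (r , e , e′) = reduce r
      , ≃-trans (*-congˡ a e) (poly-reduce μa≃0 r)
      , ≃-trans (*-congˡ b e′) (poly-reduce μb≃0 r)

    -- Horner's scheme in `r` reduces the product to sums, rational multiples and multiplication by
    -- the generator.
    conjugate-poly* : ∀ {n y y′} (r : Vec ℚ n) → Conjugate y y′ → Conjugate (poly r a * y) (poly r b * y′)
    conjugate-poly* {y = y} {y′} [] y~y′ = conjugate-resp (zero-* y) (zero-* y′) (conjugate-const 0ℚ)
      where
      zero-* : ∀ y → 0ℝ ≃ 0ℝ * y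
      zero-* y = ≃-pointwise λ i → sym (ℚ.*-zeroˡ (seq y i))
    conjugate-poly* {y = y} {y′} (c ∷ r) y~y′ = conjugate-resp (distrib a y) (distrib b y′)
      (conjugate-+ (conjugate-scale c y~y′) (conjugate-gen* (conjugate-poly* r y~y′)))
      where
      distrib : ∀ x y → fromℚ c * y + x * (poly r x * y) ≃ poly (c ∷ r) x * y
      distrib x y = ≃-pointwise λ i → solve 4 (λ c x r y → c :* y :+ x :* (r :* y) := (c :+ x :* r) :* y)
        refl c (seq x i) (seq (poly r x) i) (seq y i)

    conjugate-* : ∀ {x x′ y y′} → Conjugate x x′ → Conjugate y y′ → Conjugate (x * y) (x′ * y′)
    conjugate-* {y = y} {y′} (r , e , e′) y~y′ =
      conjugate-resp (*-congʳ y (≃-sym e)) (*-congʳ y′ (≃-sym e′)) (conjugate-poly* r y~y′)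

    conjugate-neg : ∀ {x x′} → Conjugate x x′ → Conjugate (- x) (- x′)
    conjugate-neg {x} {x′} x~x′ = conjugate-resp (neg x) (neg x′) (conjugate-scale (ℚ.- 1ℚ) x~x′)
      where
      neg : ∀ x → fromℚ (ℚ.- 1ℚ) * x ≃ - x
      neg x = ≃-pointwise λ i → solve 1 (λ x → con (ℚ.- 1ℚ) :* x := :- x) refl (seq x i)

    -- This makes `a ↦ b` well defined. Unless `r` is the zero polynomial, which vanishes at `b`
    -- too, normalising it gives a monic polynomial of degree below that of `μ` with root `a`.
    conjugate-0 : ∀ {x x′} → Conjugate x x′ → x ≃ 0ℝ → x′ ≃ 0ℝ
    conjugate-0 {x} {x′} (r , e , e′) x≃0 = conclude (normalise r)
      where
      conclude : IsZero r ⊎ IsMultipleOfMonic r → x′ ≃ 0ℝ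
      conclude (inj₁ r≃0) = ≃-trans e′ (r≃0 b)
      conclude (inj₂ (n , n<d , q , c , c≢0 , r≃cq)) =
        contradiction (minimal q (close q[a]≃0)) (ℕ.<⇒≱ n<d)
        where
        q[a]≃0 : monic q a ≃ 0ℝ
        q[a]≃0 = apart-cancel (fromℚ-apart c≢0) (≃-trans (*-comm (monic q a) (fromℚ c))
          (≃-trans (≃-sym (r≃cq a)) (≃-trans (≃-sym e) x≃0)))

  conjugation : Conjugation Conjugate
  conjugation = record
    { conj-const = conjugate-const ; conj-+ = conjugate-+ ; conj-* = conjugate-*
    ; conj-neg = conjugate-neg ; conj-0 = conjugate-0 }

  conjugate-gen : Conjugate a b
  conjugate-gen = conjugate-resp (times-1 a) (times-1 b) (conjugate-gen* (conjugate-const 1ℚ))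
    where
    times-1 : ∀ x → x * fromℚ 1ℚ ≃ x
    times-1 x = ≃-pointwise λ i → ℚ.*-identityʳ (seq x i)

  -- A rational root q of μ would force μ = X - q, hence b = q = a.
  apart-rational : ¬ (b ≃ a) → ∀ q → Apart₀ (b - fromℚ q)
  apart-rational b≄a q = split (synthetic-division μ q)
    where
    split : (Σ[ p ∈ Monic ℚ k ] ∃[ c ] ∀ x → monic μ x ≃ (x - fromℚ q) * monic p x + fromℚ c) →
            Apart₀ (b - fromℚ q)
    split (p , c , μ≃) with c ℚ.≟ 0ℚ
    -- Here `(b - q) p(b) = -c` is a nonzero rational.
    ... | no c≢0   = apart-factor c≢0 (≃-trans (≃-sym (μ≃ b)) μb≃0)
    ... | yes refl = contradiction (x-y≃0⇒x≃y (conj-0 (conj-+ conjugate-gen (conj-neg (conj-const q))) a-q≃0 ))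
                       (λ b≃q → b≄a (≃-trans b≃q (≃-sym (x-y≃0⇒x≃y a-q≃0))))
      where
      open Conjugation conjugation
      [a-q]p≃0 : (a - fromℚ q) * monic p a ≃ 0ℝ
      [a-q]p≃0 = ≃-trans (≃-pointwise λ i → sym (ℚ.+-identityʳ (seq ((a - fromℚ q) * monic p a) i)))
        (≃-trans (≃-sym (μ≃ a)) μa≃0)
      -- `p` is monic of degree `k`, below that of `μ`, so `p(a)` is not 0.
      a-q≃0 : a - fromℚ q ≃ 0ℝ
      a-q≃0 = ≄0-cancel (λ p[a]≃0 → ℕ.1+n≰n (minimal p (close p[a]≃0)))
        (≃-trans (*-comm (monic p a) (a - fromℚ q)) [a-q]p≃0)

-- `im z` is 0 only up to equality of reals, so both components are carried along the recursion.
eval-fromℝ : ∀ {n} (p : Monic ℚ n) z → im z ≃ 0ℝ →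
  re (eval ℂ-rawRing (λ q → fromℝ (fromℚ q)) p z) ≃ monic p (re z) ×
  im (eval ℂ-rawRing (λ q → fromℝ (fromℚ q)) p z) ≃ 0ℝ
eval-fromℝ []      z im≃0 = ≃-refl , ≃-refl
eval-fromℝ (c ∷ p) z im≃0 =
  let (re-p , im-p) = eval-fromℝ p z im≃0
      P = eval ℂ-rawRing (λ q → fromℝ (fromℚ q)) p z
  in ≃-trans (+-cong (≃-refl {fromℚ c}) (minus-cong (*-congˡ (re z) re-p) (*-congʳ (im P) im≃0)))
       (≃-pointwise λ i → solve 4 (λ c x m w → c :+ (x :* m :- con 0ℚ :* w) := c :+ x :* m) refl
         c (seq (re z) i) (seq (monic p (re z)) i) (seq (im P) i))
   , ≃-trans (+-cong (≃-refl {0ℝ}) (+-cong (*-congˡ (re z) im-p) (*-congʳ (re P) im≃0)))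
       (≃-pointwise λ i → solve 2 (λ x w → con 0ℚ :+ (x :* con 0ℚ :+ con 0ℚ :* w) := con 0ℚ) refl
         (seq (re z) i) (seq (re P) i))

-- Sparseness, reflection and the conclusion

module _ {a u : ℝ} (convex : ∀ {W : Pred ℝ 0ℓ} → W Respects _≈_ → IsConvex a W → IsConvex u W) where

  -- Each admissible `W` is closed under the constructors of `Hull u`. The parameter `convex` lets
  -- `u` be `1 - a` as well as `a`.
  hull⊆D : ∀ {x} → Hull u x → D a x
  hull⊆D {x} x∈ W resp W-convex ⊆W = member x∈
    where
    member : ∀ {x} → Hull u x → W x
    member hull-0            = ⊆W (inj₁ (close (≃-refl {0ℝ})))
    member hull-1            = ⊆W (inj₂ (close (≃-refl {1ℝ})))
    member (hull-step {x} {y} x∈ y∈) =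
      convex {W} resp (λ {x} {y} → W-convex {x} {y}) {x} {y} (member x∈) (member y∈)
    member (hull-resp {x} {y} e x∈) = resp {x} {y} (close e) (member x∈)

  sparse⇒hull-sparse : IsSparse a → ¬ ∃ (IsLimitPoint (Hull u))
  sparse⇒hull-sparse sparse (L , limit) = sparse (L , λ ε 0<ε →
    let (v , v∈ , near) = limit ε 0<ε in v , hull⊆D v∈ , near)

-- Exchanging `x` and `y` exchanges the two weights.
reflect-convex : ∀ {a} {W : Pred ℝ 0ℓ} → W Respects _≈_ → IsConvex a W → IsConvex (1ℝ - a) W
reflect-convex {a} resp convex {x} {y} x∈ y∈ = resp {a * y + (1ℝ - a) * x}
  (close (≃-pointwise {a * y + (1ℝ - a) * x} {(1ℝ - a) * x + (1ℝ - (1ℝ - a)) * y} λ i →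
    solve 3 (λ a x y → a :* y :+ (con 1ℚ :- a) :* x
      := (con 1ℚ :- a) :* x :+ (con 1ℚ :- (con 1ℚ :- a)) :* y) refl (seq a i) (seq x i) (seq y i)))
  (convex {y} {x} y∈ x∈)

module _ {a b : ℝ} {C : ℝ → ℝ → Set} (conj : Conjugation C) (a~b : C a b) (b≄a : ¬ (b ≃ a))
         (sparse : IsSparse a) where
  open Conjugation conj

  1<b⇒⊥ : ∀ {ρ} → 0ℚ ℚ.< ρ → AtLeast ρ (b - 1ℝ) → ⊥
  1<b⇒⊥ {ρ} 0<ρ (atLeast ρ≤b-1) = conjugate>1⇒limitPoint conj a~b {1ℚ ℚ.+ ρ} (<-by ρ 0<ρ refl)
    (atLeast (ev-map (λ i p → ≤-by _ (p≤q⇒0≤q-p p)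
      (solve 2 (λ b r → b := con 1ℚ :+ r :+ ((b :- con 1ℚ) :- r)) refl (seq b i) ρ)) ρ≤b-1))
    b≄a (sparse⇒hull-sparse (λ _ convex {x} {y} → convex {x} {y}) sparse)

  b<0⇒⊥ : ∀ {ρ} → 0ℚ ℚ.< ρ → AtLeast ρ (- (b - 0ℝ)) → ⊥
  b<0⇒⊥ {ρ} 0<ρ (atLeast ρ≤-b) = conjugate>1⇒limitPoint conj
    (conj-+ (conj-const 1ℚ) (conj-neg a~b)) {1ℚ ℚ.+ ρ} (<-by ρ 0<ρ refl)
    (atLeast (ev-map (λ i p → ≤-by _ (p≤q⇒0≤q-p p)
      (solve 2 (λ b r → con 1ℚ :- b := con 1ℚ :+ r :+ (:- (b :- con 0ℚ) :- r)) refl (seq b i) ρ)) ρ≤-b))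
    (λ 1-b≃1-a → b≄a (≃-trans (1-[1-x]≃x b) (≃-trans (minus-cong (≃-refl {1ℝ}) 1-b≃1-a) (≃-sym (1-[1-x]≃x a)))))
    (sparse⇒hull-sparse (λ {W} resp convex {x} {y} → reflect-convex {a} {W} resp (λ {x} {y} → convex {x} {y}) {x} {y}) sparse)
    where
    1-[1-x]≃x : ∀ x → x ≃ 1ℝ - (1ℝ - x)
    1-[1-x]≃x x = ≃-pointwise λ i →
      solve 1 (λ x → x := con 1ℚ :- (con 1ℚ :- x)) refl (seq x i)

  -- Refuting `b < 0` gives only a negation; apartness from 0 settles the sign and supplies the
  -- rational gap that `<` demands.
  0<b : Apart₀ (b - 0ℝ) → 0ℝ < b
  0<b b#0 = positive (apart-sign b#0)
    where
    positive : ∃[ ρ ] 0ℚ ℚ.< ρ × (AtLeast ρ (b - 0ℝ) ⊎ AtLeast ρ (- (b - 0ℝ))) → 0ℝ < b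
    positive (ρ , 0<ρ , inj₁ (atLeast h)) = ρ , 0<ρ , ev-map (λ i p → ≤-by _ (p≤q⇒0≤q-p p)
      (solve 2 (λ b r → b := con 0ℚ :+ r :+ ((b :- con 0ℚ) :- r)) refl (seq b i) ρ)) h
    positive (ρ , 0<ρ , inj₂ h) = ⊥-elim (b<0⇒⊥ 0<ρ h)

  b<1 : Apart₀ (b - 1ℝ) → b < 1ℝ
  b<1 b#1 = below-1 (apart-sign b#1)
    where
    below-1 : ∃[ ρ ] 0ℚ ℚ.< ρ × (AtLeast ρ (b - 1ℝ) ⊎ AtLeast ρ (- (b - 1ℝ))) → b < 1ℝ
    below-1 (ρ , 0<ρ , inj₁ h) = ⊥-elim (1<b⇒⊥ 0<ρ h)
    below-1 (ρ , 0<ρ , inj₂ (atLeast h)) = ρ , 0<ρ , ev-map (λ i p → ≤-by _ (p≤q⇒0≤q-p p)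
      (solve 2 (λ b r → con 1ℚ := b :+ r :+ (:- (b :- con 1ℚ) :- r)) refl (seq b i) ρ)) h

theorem2 : (a : ℝ) → IsAlgebraicInteger a → IsTotallyReal a → IsSparse a →
    (z : ℂ) → z IsConjugateOf a → ¬ (z ≈ℂ fromℝ a) → z ∈⟨0,1⟩
-- The monic polynomial of degree 0 is the constant 1 and has no root.
theorem2 a _ totallyReal sparse z (zero , [] , μ-min , _) z≉a =
  ⊥-elim (apart⇒≄0 {1ℝ} (fromℚ-apart λ ()) (equal (IsMinimalPolynomial.root μ-min)))
theorem2 a _ totallyReal sparse z z~a@(suc k , μ , μ-min , root) z≉a =
  b , 0<b conj a~b b≄a sparse (apart-rational μ-min μb≃0 b≄a 0ℚ)
    , b<1 conj a~b b≄a sparse (apart-rational μ-min μb≃0 b≄a 1ℚ)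
    , close (≃-refl {b}) , im≈0
  where
  b : ℝ
  b = re z

  im≈0 : im z ≈ 0ℝ
  im≈0 = totallyReal z z~a

  μb≃0 : monic μ b ≃ 0ℝ
  μb≃0 = ≃-trans (≃-sym (proj₁ (eval-fromℝ μ z (equal im≈0)))) (equal (proj₁ root))

  b≄a : ¬ (b ≃ a)
  b≄a b≃a = z≉a (close b≃a , im≈0)

  conj : Conjugation (Conjugate μ-min μb≃0)
  conj = conjugation μ-min μb≃0

  a~b : Conjugate μ-min μb≃0 a b
  a~b = conjugate-gen μ-min μb≃0
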